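{- Let $\pi\in S_n$ be inverse-Grassmannian. There is a bijection $f:\mathrm{BPD}(\pi)\to\mathrm{PD}^{red}(\pi)$ such that $\mathrm{wt}(f(D))=\mathrm{wt}(D)$ for all $D$ and $f$ is an isomorphism of posets from $\mathrm{droop}(\pi)$ to $\mathrm{slide}(\pi)$, i.e. $D\le E$ in $\mathrm{droop}(\pi)$ iff $f(D)\le f(E)$ in $\mathrm{slide}(\pi)$.
   Context: $\pi$ is Grassmannian if it has at most one descent (index $i$ with $\pi(i)>\pi(i+1)$); inverse-Grassmannian if $\pi^{ -1}$ is Grassmannian. Pipe dreams: tilings of the $n\times n$ grid (rows top to bottom, columns left to right) by cross tiles and elbow tiles (arcs joining north–west and south–east edges), with all positions $(i,j)$, $i+j\ge n+1$, elbows; pipes $1..n$ enter at the north border (pipe $j$ above column $j$) and exit at the west border; reduced if no two pipes cross twice, with permutation $\pi(i)$ = label of pipe exiting row $i$. $\mathrm{PD}^{red}(\pi)$ = reduced pipe dreams with permutation $\pi$; weight $\prod x_r$ over crosses $(r,c)$. The bottom pipe dream is the unique element of $\mathrm{PD}^{red}(\pi)$ whose crosses in each row are left-justified. A simple slide: if a pipe dream has a cross at $(r,c)$ and elbows at $(r,c+1),(r-1,c),(r-1,c+1)$, move the cross to $(r-1,c+1)$. $\mathrm{slide}(\pi)$ is the set of pipe dreams reachable from the bottom pipe dream by sequences of simple slides, ordered by the reflexive–transitive closure of $D<D'$ when $D'$ is obtained from $D$ by a simple slide. Bumpless pipe dreams (BPD): tilings of the $n\times n$ grid by cross, horizontal,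 vertical, r-tile (elbow joining south and east edges), j-tile (elbow joining north and west edges), and blank tiles forming $n$ pipes from the south border to the east border; reduced if no two pipes cross twice; pipes labelled $1..n$ left to right on the south border, permutation $\pi(i)$ = label of pipe exiting row $i$. $\mathrm{BPD}(\pi)$ = reduced BPDs with permutation $\pi$; weight $\prod x_i$ over blank tiles $(i,j)$. The Rothe BPD of $\pi$ is the BPD whose r-tiles are at positions $(i,\pi(i))$ and which has no j-tiles. A simple droop: if $(i,j)$ is an r-tile and $(i+1,j+1)$ is blank, then $(i+1,j)$ is a vertical tile or j-tile and $(i,j+1)$ is a horizontal tile or j-tile; replace $(i,j)$ by blank, $(i+1,j+1)$ by a j-tile, $(i+1,j)$ by an r-tile (if it was vertical) or a horizontal tile (if it was a j-tile), and $(i,j+1)$ by an r-tile (if it was horizontal) or a vertical tile (if it was a j-tile). $\mathrm{droop}(\pi)$ is the set of BPDs reachable from the Rothe BPD by sequences of simple droops, ordered by the reflexive–transitive closure of $D<D'$ when $D'$ is obtained from $D$ by a simple droop. (For such $\pi$ it is known that the underlying sets of $\mathrm{droop}(\pi)$ and $\mathrm{slide}(\pi)$ are $\mathrm{BPD}(\pi)$ and $\mathrm{PD}^{red}(\pi)$.) -}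

module Defs where

open import Data.Nat using (ℕ; zero; suc; _+_; _∸_; _<_; _≤ᵇ_; _≡ᵇ_)
open import Data.Bool using (Bool; true; false; _∧_; _∨_; not; T; if_then_else_)
open import Data.Fin using (Fin; toℕ)
open import Data.Fin.Permutation using (Permutation′; _⟨$⟩ʳ_; _⟨$⟩ˡ_)
open import Data.Maybe using (Maybe; just; nothing)
open import Data.List using (List; []; _∷_; _++_; map; length; zipWith; allFin; filter)
open import Data.Bool.ListAction using (all; and)
open import Data.Vec using (Vec; []; _∷_; toList)
open import Data.Product using (Σ; _×_; _,_; proj₁)
open import Relation.Binary.PropositionalEquality using (_≡_)

Descent : ∀ {n} → (Fin n → Fin n) → Fin n → Fin n → Set
Descent σ i j = (toℕ j ≡ suc (toℕ i)) × (toℕ (σ j) < toℕ (σ i))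

Grassmannian : ∀ {n} → (Fin n → Fin n) → Set
Grassmannian σ = ∀ i j k l → Descent σ i j → Descent σ k l → i ≡ k

InverseGrassmannian : ∀ {n} → Permutation′ n → Set
InverseGrassmannian π = Grassmannian (π ⟨$⟩ˡ_)

Grid : Set → ℕ → Set
Grid A n = Vec (Vec A n) n

atV : ∀ {A : Set} {m} → Vec A m → ℕ → Maybe A
atV []       _       = nothing
atV (x ∷ xs) zero    = just x
atV (x ∷ xs) (suc k) = atV xs k

at : ∀ {A : Set} {n} → Grid A n → ℕ → ℕ → Maybe A
at D i j with atV D i
... | nothing  = nothing
... | just row = atV row j

updV : ∀ {A : Set} {m} → Vec A m → ℕ → (A → A) → Vec A m
updV []       _       f = []
updV (x ∷ xs) zero    f = f x ∷ xs
updV (x ∷ xs) (suc k) f = x ∷ updV xs k f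

setV : ∀ {A : Set} {m} → Vec A m → ℕ → A → Vec A m
setV v k a = updV v k (λ _ → a)

set : ∀ {A : Set} {n} → Grid A n → ℕ → ℕ → A → Grid A n
set D i j a = updV D i (λ row → setV row j a)

rows : ∀ {A : Set} {n} → Grid A n → List (List A)
rows D = map toList (toList D)

count : ∀ {A : Set} → (A → Bool) → List A → ℕ
count p xs = length (filter (λ x → T? (p x)) xs)
  where
  open import Relation.Nullary using (Dec; yes; no)
  open import Data.Unit using (tt)
  T? : (b : Bool) → Dec (T b)
  T? true  = yes tt
  T? false = no (λ ())

Label : Set
Label = Maybe ℕ

eqL : Label → Label → Bool
eqL nothing  nothing  = true
eqL (just a) (just b) = a ≡ᵇ b
eqL _        _        = false

samePair : Label × Label → Label × Label → Bool
samePair (a , b) (c , d) = (eqL a c ∧ eqL b d) ∨ (eqL a d ∧ eqL b c)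

noRepeat : List (Label × Label) → Bool
noRepeat []       = true
noRepeat (p ∷ ps) = all (λ q → not (samePair p q)) ps ∧ noRepeat ps

-- initial labels: pipe j sits at column j (labels 0..n-1 for pipes 1..n)
initLabels : ℕ → List Label
initLabels n = map (λ j → just (toℕ j)) (allFin n)

permList : ∀ {n} → Permutation′ n → List Label
permList {n} π = map (λ i → just (toℕ (π ⟨$⟩ʳ i))) (allFin n)

eqBool : Bool → Bool → Bool
eqBool true  b = b
eqBool false b = not b

data PTile : Set where
  pcross pelbow : PTile

isPCross : PTile → Bool
isPCross pcross = true
isPCross pelbow = false

PGrid : ℕ → Set
PGrid n = Grid PTile n

-- all positions (i,j) with i+j ≥ n+1 (1-indexed), i.e. i+j ≥ n-1 (0-indexed), are elbows
pdShape : ∀ {n} → PGrid n → Bool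
pdShape {n} D = all (λ i → all (λ j → ok i j) (allFin n)) (allFin n)
  where
  ok : Fin n → Fin n → Bool
  ok i j with at D (toℕ i) (toℕ j)
  ... | just pcross = not ((n ∸ 1) ≤ᵇ (toℕ i + toℕ j))
  ... | _           = true

-- one row, traversed right to left.  Input: labels entering from the north
-- (left to right) and the label entering the rightmost tile from the east.
-- Output: labels leaving to the south, label leaving the row to the west,
-- and the crossings (pairs of pipes) in this row.
pRow : List PTile → List Label → Label → List Label × Label × List (Label × Label)
pRow (t ∷ ts) (nl ∷ ns) e with pRow ts ns e
... | (ss , w , cs) with t
...   | pcross = (nl ∷ ss , w  , (nl , w) ∷ cs)
...   | pelbow = (w  ∷ ss , nl , cs)
pRow _ _ e = ([] , e , [])

-- rows top to bottom; returns labels exiting each row west, and all crossings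
pGrid : List (List PTile) → List Label → List Label × List (Label × Label)
pGrid []         nth = ([] , [])
pGrid (r ∷ rs) nth with pRow r nth nothing
... | (s , w , c) with pGrid rs s
...   | (ws , cs) = (w ∷ ws , c ++ cs)

pdTrace : ∀ {n} → PGrid n → List Label × List (Label × Label)
pdTrace {n} D = pGrid (rows D) (initLabels n)

PDred : ∀ {n} → Permutation′ n → Set
PDred {n} π = Σ (PGrid n) λ D →
  T (pdShape D) × T (noRepeat (Data.Product.proj₂ (pdTrace D))) × (proj₁ (pdTrace D) ≡ permList π)

-- weight ∏ x_r over crosses (r,c), as its exponent vector (row by row)
wtPD : ∀ {n} → PGrid n → List ℕ
wtPD D = map (count isPCross) (rows D)

data SimpleSlide {n} (D D' : PGrid n) : Set where
  slide : (r c : ℕ) →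
    at D (suc r) c ≡ just pcross →
    at D (suc r) (suc c) ≡ just pelbow →
    at D r c ≡ just pelbow →
    at D r (suc c) ≡ just pelbow →
    D' ≡ set (set D (suc r) c pelbow) r (suc c) pcross →
    SimpleSlide D D'

-- bcross, horizontal, vertical, r-tile (south–east), j-tile (north–west), blank
data BTile : Set where
  bcross bhor bver br bj bblank : BTile

edgeN edgeS edgeE edgeW : BTile → Bool
edgeN bcross = true
edgeN bver   = true
edgeN bj     = true
edgeN _      = false
edgeS bcross = true
edgeS bver   = true
edgeS br     = true
edgeS _      = false
edgeE bcross = true
edgeE bhor   = true
edgeE br     = true
edgeE _      = false
edgeW bcross = true
edgeW bhor   = true
edgeW bj     = true
edgeW _      = false

isBlank : BTile → Bool
isBlank bblank = true
isBlank _      = false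

BGrid : ℕ → Set
BGrid n = Grid BTile n

rowRest : BTile → List BTile → Bool
rowRest t []       = edgeE t
rowRest t (u ∷ us) = eqBool (edgeE t) (edgeW u) ∧ rowRest u us

rowOK : List BTile → Bool
rowOK []       = true
rowOK (t ∷ ts) = not (edgeW t) ∧ rowRest t ts

vertRest : List BTile → List (List BTile) → Bool
vertRest r []        = all edgeS r
vertRest r (r' ∷ rs) = and (zipWith (λ a b → eqBool (edgeS a) (edgeN b)) r r') ∧ vertRest r' rs

colsOK : List (List BTile) → Bool
colsOK []       = true
colsOK (r ∷ rs) = all (λ t → not (edgeN t)) r ∧ vertRest r rs

bpdShape : ∀ {n} → BGrid n → Bool
bpdShape D = all rowOK (rows D) ∧ colsOK (rows D)

-- one row, traversed left to right.  Input: labels entering from the south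
-- and the label entering from the west.  Output: labels leaving north,
-- label leaving east, crossings of this row.
bRow : List BTile → List Label → Label → List Label × Label × List (Label × Label)
bRow (t ∷ ts) (s ∷ ss) w with t
... | bcross with bRow ts ss w
...   | (ns , e , cs) = (s ∷ ns , e , (s , w) ∷ cs)
bRow (t ∷ ts) (s ∷ ss) w | bhor with bRow ts ss w
...   | (ns , e , cs) = (nothing ∷ ns , e , cs)
bRow (t ∷ ts) (s ∷ ss) w | bver with bRow ts ss w
...   | (ns , e , cs) = (s ∷ ns , e , cs)
bRow (t ∷ ts) (s ∷ ss) w | br with bRow ts ss s
...   | (ns , e , cs) = (nothing ∷ ns , e , cs)
bRow (t ∷ ts) (s ∷ ss) w | bj with bRow ts ss nothing
...   | (ns , e , cs) = (w ∷ ns , e , cs)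
bRow (t ∷ ts) (s ∷ ss) w | bblank with bRow ts ss nothing
...   | (ns , e , cs) = (nothing ∷ ns , e , cs)
bRow _ _ w = ([] , w , [])

-- rows listed top to bottom, traced bottom to top.  Returns the labels
-- leaving the top of the block, the labels exiting each row east
-- (top to bottom), and all crossings.
bGrid : List (List BTile) → List Label → List Label × List Label × List (Label × Label)
bGrid []       s = (s , [] , [])
bGrid (r ∷ rs) s with bGrid rs s
... | (nb , es , cs) with bRow r nb nothing
...   | (nr , e , c) = (nr , e ∷ es , c ++ cs)

bpdTrace : ∀ {n} → BGrid n → List Label × List (Label × Label)
bpdTrace {n} D with bGrid (rows D) (initLabels n)
... | (_ , es , cs) = (es , cs)

BPD : ∀ {n} → Permutation′ n → Set
BPD {n} π = Σ (BGrid n) λ D →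
  T (bpdShape D) × T (noRepeat (Data.Product.proj₂ (bpdTrace D))) × (proj₁ (bpdTrace D) ≡ permList π)

-- weight ∏ x_i over blank tiles (i,j), as exponent vector (row by row)
wtBPD : ∀ {n} → BGrid n → List ℕ
wtBPD D = map (count isBlank) (rows D)

droopBelow : BTile → Maybe BTile
droopBelow bver = just br
droopBelow bj   = just bhor
droopBelow _    = nothing

droopRight : BTile → Maybe BTile
droopRight bhor = just br
droopRight bj   = just bver
droopRight _    = nothing

data SimpleDroop {n} (D D' : BGrid n) : Set where
  droop : (i j : ℕ) (tb tr tb' tr' : BTile) →
    at D i j ≡ just br →
    at D (suc i) (suc j) ≡ just bblank →
    at D (suc i) j ≡ just tb →
    at D i (suc j) ≡ just tr →
    droopBelow tb ≡ just tb' →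
    droopRight tr ≡ just tr' →
    D' ≡ set (set (set (set D i j bblank) (suc i) (suc j) bj) (suc i) j tb') i (suc j) tr' →
    SimpleDroop D D'

{-# OPTIONS --safe #-}

-- Write π as a shuffle of the small labels 0 , … , k − 1 and the large labels k , … , n − 1, both increasing.
-- In either model the frontier of the labels read so far changes only by swapping two neighbours at a crossing,
-- so a diagram is reduced with permutation π iff each crossing has a small left pipe and a large right pipe and
-- the exits have the right sizes.  Hence only the sizes of the labels matter.
--
-- In a bumpless pipe dream this forces the columns j ≥ k to be those of the Rothe diagram and leaves no crossing
-- in the columns j < k.  There, match column j with column c = k − 1 − j of a pipe dream, blank tiles with
-- crossings and all other tiles with elbows: a horizontal edge is used iff the pipe of the pipe dream at the
-- corresponding place is small, a vertical edge is used iff it is not small, and the local rules agree.  Under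
-- this dictionary a simple droop and a simple slide are the same move of a blank cell, and rows keep their weight.
module Submission where

open import Defs
open import Data.Nat using (ℕ; zero; suc; _+_; _∸_; _≤_; _<_; _≡ᵇ_; _<ᵇ_; _≤ᵇ_; z≤n; s≤s; s<s; z<s; s≤s⁻¹; s<s⁻¹)
open import Data.Nat.Properties
open import Data.Bool using (Bool; true; false; _∧_; _∨_; not; T; if_then_else_)
open import Data.Bool.Properties using (T-∧; T-≡; T-not-≡; T-∨; T-irrelevant; ∧-zeroʳ; not-involutive)
open import Data.Bool.ListAction using (all; and)
open import Data.Unit using (tt)
open import Data.Empty using (⊥-elim)
open import Data.Maybe using (just; nothing; is-just; fromMaybe)
open import Data.Maybe.Properties using (just-injective)
open import Data.Fin using (Fin; toℕ; fromℕ<)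
open import Data.Fin.Permutation using (Permutation′; _⟨$⟩ʳ_; _⟨$⟩ˡ_; inverseˡ; inverseʳ)
open import Data.Fin.Properties using (any?; toℕ-fromℕ<; toℕ<n; fromℕ<-toℕ)
open import Data.List using (List; []; _∷_; _++_; map; length; zipWith; allFin; filter; applyUpTo; applyDownFrom; upTo; tabulate; catMaybes)
open import Data.List.Properties using (∷-injective; ∷-injectiveˡ; ∷-injectiveʳ; ++-assoc; ++-identityʳ; map-++; map-cong; map-tabulate; map-applyUpTo; catMaybes-++)
open import Data.List.Membership.Propositional using (_∈_)
open import Data.List.Membership.Propositional.Properties using (∈-++⁺ʳ; ∈-++⁺ˡ)
open import Data.List.Relation.Unary.Any using (here; there)
open import Data.List.Relation.Unary.All using (All; []; _∷_)
import Data.List.Relation.Unary.All as All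
import Data.List.Relation.Unary.All.Properties as Allₚ
open import Data.List.Relation.Unary.AllPairs using (AllPairs; []; _∷_)
import Data.List.Relation.Unary.AllPairs as AllPairs
import Data.List.Relation.Unary.AllPairs.Properties as AllPairsₚ
open import Data.List.Relation.Unary.Unique.Propositional using (Unique)
open import Data.List.Relation.Unary.Unique.Propositional.Properties using (upTo⁺)
open import Data.List.Relation.Binary.Permutation.Propositional using (_↭_; ↭-refl; ↭-sym; ↭-trans; ↭⇒↭ₛ)
import Data.List.Relation.Binary.Permutation.Propositional as ↭
open import Data.List.Relation.Binary.Permutation.Propositional.Properties using (++⁺; ++⁺ˡ; ++-comm; ∈-resp-↭; All-resp-↭)
import Data.List.Relation.Binary.Permutation.Setoid.Properties as ↭ₛ
open import Data.Vec using (Vec; []; _∷_; toList)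
open import Data.Product using (Σ; ∃; ∃₂; _×_; _,_; proj₁; proj₂)
open import Data.Sum using (_⊎_; inj₁; inj₂)
open import Function using (_∘_; id)
open import Function.Bundles using (Equivalence; _⇔_; mk⇔)
open import Function.Definitions using (Bijective)
open import Relation.Nullary using (Dec; yes; no; does; ¬_)
open import Relation.Nullary.Decidable using (_×-dec_)
open import Relation.Binary.Definitions using (tri<; tri≈; tri>)
open import Relation.Binary.PropositionalEquality
open import Relation.Binary.Construct.Closure.ReflexiveTransitive using (Star; ε; _◅_)
open import Axiom.UniquenessOfIdentityProofs.WithK using (uip)

-- The permutation of a diagram is global information, while the rules for tiles are local. A
-- configuration is encoded by `bpd` and by `pd`, every valid diagram of either kind is decoded by
-- recording which edges are used or which labels are small, and the bijection decodes on one side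
-- and encodes on the other. Sizes suffice for two reasons. A pair that crosses only once ends up as
-- an inversion of π, and since the inverse of π increases on each class, an inversion has a small
-- and a large label. Conversely, exchanging a small label with a large one on its right cannot be
-- undone by another such exchange and preserves the order within each class, so the sizes of the
-- exits leave only one possible word. The bound `k` is the position of the descent of the inverse,
-- or `n` if there is none. The `m = n ∸ k` extra columns of a configuration account for the fact
-- that a pipe dream has `n` columns while only `k` columns of a bumpless pipe dream can vary.

private variable
  A B : Set

-- Grids as functions on indices

fromFun : (ℕ → A) → ∀ n → Vec A n
fromFun f zero    = []
fromFun f (suc n) = f 0 ∷ fromFun (f ∘ suc) n

getV : ∀ {n} → A → Vec A n → ℕ → A
getV a []      _       = a
getV a (x ∷ v) zero    = x
getV a (x ∷ v) (suc i) = getV a v i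

fromFun-getV : ∀ {n} a (v : Vec A n) → fromFun (getV a v) n ≡ v
fromFun-getV a []      = refl
fromFun-getV a (x ∷ v) = cong (x ∷_) (fromFun-getV a v)

fromFun-cong : ∀ {f g : ℕ → A} n → (∀ i → i < n → f i ≡ g i) → fromFun f n ≡ fromFun g n
fromFun-cong zero    e = refl
fromFun-cong (suc n) e = cong₂ _∷_ (e 0 z<s) (fromFun-cong n λ i i<n → e (suc i) (s<s i<n))

atV-fromFun : ∀ (f : ℕ → A) {n i} → i < n → atV (fromFun f n) i ≡ just (f i)
atV-fromFun f {suc n} {zero}  _   = refl
atV-fromFun f {suc n} {suc i} i<n = atV-fromFun (f ∘ suc) (s<s⁻¹ i<n)

atV-fromFun-≥ : ∀ (f : ℕ → A) {n i} → n ≤ i → atV (fromFun f n) i ≡ nothing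
atV-fromFun-≥ f {zero}            _   = refl
atV-fromFun-≥ f {suc n} {suc i} n≤i = atV-fromFun-≥ (f ∘ suc) (s≤s⁻¹ n≤i)

updV-fromFun : ∀ (f : ℕ → A) n i (g : A → A) →
  updV (fromFun f n) i g ≡ fromFun (λ a → if a ≡ᵇ i then g (f a) else f a) n
updV-fromFun f zero    i       g = refl
updV-fromFun f (suc n) zero    g = cong (g (f 0) ∷_) (fromFun-cong n λ _ _ → refl)
updV-fromFun f (suc n) (suc i) g = cong (f 0 ∷_) (updV-fromFun (f ∘ suc) n i g)

toList-fromFun : ∀ (f : ℕ → A) n → toList (fromFun f n) ≡ applyUpTo f n
toList-fromFun f zero    = refl
toList-fromFun f (suc n) = cong (f 0 ∷_) (toList-fromFun (f ∘ suc) n)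

grid : (ℕ → ℕ → A) → ∀ n → Grid A n
grid φ n = fromFun (λ i → fromFun (φ i) n) n

entry : ∀ {n} → A → Grid A n → ℕ → ℕ → A
entry {n = n} a D i j = getV a (getV (fromFun (λ _ → a) n) D i) j

update : (ℕ → ℕ → A) → ℕ → ℕ → A → ℕ → ℕ → A
update φ i j x a b = if (a ≡ᵇ i) ∧ (b ≡ᵇ j) then x else φ a b

grid-entry : ∀ {n} a (D : Grid A n) → grid (entry a D) n ≡ D
grid-entry {n = n} a D = trans
  (fromFun-cong n λ i _ → fromFun-getV a (getV (fromFun (λ _ → a) n) D i))
  (fromFun-getV (fromFun (λ _ → a) n) D)

grid-cong : ∀ {φ ψ : ℕ → ℕ → A} n → (∀ i j → i < n → j < n → φ i j ≡ ψ i j) → grid φ n ≡ grid ψ n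
grid-cong n e = fromFun-cong n λ i i<n → fromFun-cong n λ j j<n → e i j i<n j<n

at-grid : ∀ (φ : ℕ → ℕ → A) {n i j} → i < n → j < n → at (grid φ n) i j ≡ just (φ i j)
at-grid φ {n} {i} i<n j<n rewrite atV-fromFun (λ i → fromFun (φ i) n) i<n = atV-fromFun (φ i) j<n

at-grid⁻ : ∀ (φ : ℕ → ℕ → A) {n i j x} → at (grid φ n) i j ≡ just x → i < n × j < n × φ i j ≡ x
at-grid⁻ φ {n} {i} {j} e with i <? n
at-grid⁻ φ {n} {i} {j} e | no i≮n
  rewrite atV-fromFun-≥ (λ i → fromFun (φ i) n) (≮⇒≥ i≮n) with () ← e
at-grid⁻ φ {n} {i} {j} e | yes i<n with j <? n
... | yes j<n = i<n , j<n , just-injective (trans (sym (at-grid φ i<n j<n)) e)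
... | no  j≮n rewrite atV-fromFun (λ i → fromFun (φ i) n) i<n | atV-fromFun-≥ (φ i) (≮⇒≥ j≮n) with () ← e

grid-injective : ∀ {φ ψ : ℕ → ℕ → A} {n} → grid φ n ≡ grid ψ n → ∀ {i j} → i < n → j < n → φ i j ≡ ψ i j
grid-injective {φ = φ} {ψ} e {i} {j} i<n j<n = just-injective
  (trans (sym (at-grid φ i<n j<n)) (trans (cong (λ D → at D i j) e) (at-grid ψ i<n j<n)))

set-grid : ∀ (φ : ℕ → ℕ → A) n i j x → set (grid φ n) i j x ≡ grid (update φ i j x) n
set-grid φ n i j x = trans (updV-fromFun (λ a → fromFun (φ a) n) n i (λ row → setV row j x))
  (fromFun-cong n λ a _ → row a)
  where
  row : ∀ a → (if a ≡ᵇ i then setV (fromFun (φ a) n) j x else fromFun (φ a) n)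
            ≡ fromFun (update φ i j x a) n
  row a with a ≡ᵇ i
  ... | true  = updV-fromFun (φ a) n j (λ _ → x)
  ... | false = refl

-- Lists of function values, read from either end.

applyUpTo-cong : ∀ {f g : ℕ → A} n → (∀ i → i < n → f i ≡ g i) → applyUpTo f n ≡ applyUpTo g n
applyUpTo-cong zero    e = refl
applyUpTo-cong (suc n) e = cong₂ _∷_ (e 0 z<s) (applyUpTo-cong n λ i i<n → e (suc i) (s<s i<n))

applyDownFrom-cong : ∀ {f g : ℕ → A} n → (∀ i → i < n → f i ≡ g i) → applyDownFrom f n ≡ applyDownFrom g n
applyDownFrom-cong zero    e = refl
applyDownFrom-cong (suc n) e = cong₂ _∷_ (e n (n<1+n n)) (applyDownFrom-cong n λ i i<n → e i (m<n⇒m<1+n i<n))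

applyUpTo-injective : ∀ {f g : ℕ → A} n → applyUpTo f n ≡ applyUpTo g n → ∀ {i} → i < n → f i ≡ g i
applyUpTo-injective (suc n) e {zero}  _   = proj₁ (∷-injective e)
applyUpTo-injective (suc n) e {suc i} i<n = applyUpTo-injective n (proj₂ (∷-injective e)) (s<s⁻¹ i<n)

suc∸suc : ∀ {d n} → d < n → suc (n ∸ suc d) ≡ n ∸ d
suc∸suc {zero}  {suc n} _   = refl
suc∸suc {suc d} {suc n} d<n = suc∸suc (s<s⁻¹ d<n)

-- Rows of pipe dreams are traced from the right. With columns numbered from the right, dropping the
-- leftmost tile shortens the list without shifting the function, which suits the recursion of
-- `pRow`.
applyUpTo-reversed : ∀ (f : ℕ → A) n → applyUpTo f n ≡ applyDownFrom (λ d → f (n ∸ suc d)) n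
applyUpTo-reversed f zero    = refl
applyUpTo-reversed f (suc n) = cong₂ _∷_ (cong f (sym (n∸n≡0 n)))
  (trans (applyUpTo-reversed (f ∘ suc) n) (applyDownFrom-cong n λ d d<n → cong f (suc∸suc d<n)))

tabulate-toℕ : ∀ (f : ℕ → A) n → tabulate {n = n} (f ∘ toℕ) ≡ applyUpTo f n
tabulate-toℕ f zero    = refl
tabulate-toℕ f (suc n) = cong (f 0 ∷_) (tabulate-toℕ (f ∘ suc) n)

map-allFin : ∀ (f : ℕ → A) n → map (f ∘ toℕ) (allFin n) ≡ applyUpTo f n
map-allFin f n = trans (map-tabulate {n = n} id (f ∘ toℕ)) (tabulate-toℕ f n)

rows-grid : ∀ (φ : ℕ → ℕ → A) n → rows (grid φ n) ≡ applyUpTo (λ i → applyUpTo (φ i) n) n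
rows-grid φ n = trans (cong (map toList) (toList-fromFun (λ i → fromFun (φ i) n) n))
  (trans (map-applyUpTo (λ i → fromFun (φ i) n) toList n) (applyUpTo-cong n λ i _ → toList-fromFun (φ i) n))

-- Counting tiles in a row.

bit : Bool → ℕ
bit b = if b then 1 else 0

tally : (ℕ → Bool) → ℕ → ℕ
tally f zero    = 0
tally f (suc n) = bit (f n) + tally f n

tally-cong : ∀ {f g : ℕ → Bool} n → (∀ i → i < n → f i ≡ g i) → tally f n ≡ tally g n
tally-cong zero    e = refl
tally-cong (suc n) e = cong₂ _+_ (cong bit (e n (n<1+n n))) (tally-cong n λ i i<n → e i (m<n⇒m<1+n i<n))

tally-none : ∀ {f : ℕ → Bool} n → (∀ i → i < n → f i ≡ false) → tally f n ≡ 0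
tally-none zero    e = refl
tally-none (suc n) e rewrite e n (n<1+n n) = tally-none n λ i i<n → e i (m<n⇒m<1+n i<n)

tally-suc : ∀ f n → tally f (suc n) ≡ bit (f 0) + tally (f ∘ suc) n
tally-suc f zero    = refl
tally-suc f (suc n) = trans (cong (bit (f (suc n)) +_) (tally-suc f n))
  (trans (sym (+-assoc (bit (f (suc n))) (bit (f 0)) _))
    (trans (cong (_+ tally (f ∘ suc) n) (+-comm (bit (f (suc n))) (bit (f 0))))
      (+-assoc (bit (f 0)) _ _)))

tally-+ : ∀ f m k → tally f (m + k) ≡ tally f m + tally (λ j → f (m + j)) k
tally-+ f zero    k = refl
tally-+ f (suc m) k = trans (tally-suc f (m + k)) (trans (cong (bit (f 0) +_) (tally-+ (f ∘ suc) m k))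
  (trans (sym (+-assoc (bit (f 0)) _ _)) (cong (_+ tally (λ j → f (suc m + j)) k) (sym (tally-suc f m)))))

does-T : ∀ {b} (d : Dec (T b)) → does d ≡ b
does-T {true}  (yes _) = refl
does-T {true}  (no ¬t) = ⊥-elim (¬t tt)
does-T {false} (no _)  = refl

length-filter : ∀ (p : A → Bool) (P? Q? : ∀ x → Dec (T (p x))) xs → length (filter P? xs) ≡ length (filter Q? xs)
length-filter p P? Q? []       = refl
length-filter p P? Q? (x ∷ xs) rewrite does-T (P? x) | does-T (Q? x) with p x
... | true  = cong suc (length-filter p P? Q? xs)
... | false = length-filter p P? Q? xs

-- Two deciders, because the one inside count depends on the list.
length-filter-∷ : ∀ (p : A → Bool) (P? Q? : ∀ x → Dec (T (p x))) ys {x xs} → ys ≡ x ∷ xs →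
  length (filter P? ys) ≡ bit (p x) + length (filter Q? xs)
length-filter-∷ p P? Q? _ {x} {xs} refl rewrite does-T (P? x) with p x
... | true  = cong suc (length-filter p P? Q? xs)
... | false = length-filter p P? Q? xs

count-≡∷ : ∀ (p : A → Bool) ys {x} xs → ys ≡ x ∷ xs → count p ys ≡ bit (p x) + count p xs
count-≡∷ p ys xs = length-filter-∷ p _ _ ys

count-∷ : ∀ (p : A → Bool) x xs → count p (x ∷ xs) ≡ bit (p x) + count p xs
count-∷ p x xs = count-≡∷ p (x ∷ xs) xs refl

count-applyUpTo : ∀ (p : A → Bool) f n → count p (applyUpTo f n) ≡ tally (p ∘ f) n
count-applyUpTo p f zero    = refl
count-applyUpTo p f (suc n) = trans (count-∷ p (f 0) _)
  (trans (cong (bit (p (f 0)) +_) (count-applyUpTo p (f ∘ suc) n)) (sym (tally-suc (p ∘ f) n)))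

count-applyDownFrom : ∀ (p : A → Bool) f n → count p (applyDownFrom f n) ≡ tally (p ∘ f) n
count-applyDownFrom p f zero    = refl
count-applyDownFrom p f (suc n) = trans (count-∷ p (f n) _)
  (cong (bit (p (f n)) +_) (count-applyDownFrom p f n))

-- Boolean tests and the propositions they decide.

∧-split : ∀ {a b} → T (a ∧ b) → T a × T b
∧-split = Equivalence.to T-∧

∧-pair : ∀ {a b} → T a → T b → T (a ∧ b)
∧-pair x y = Equivalence.from T-∧ (x , y)

T⇒≡ : ∀ {b} → T b → b ≡ true
T⇒≡ = Equivalence.to T-≡

T-not⇒≡ : ∀ {b} → T (not b) → b ≡ false
T-not⇒≡ = Equivalence.to T-not-≡

≡⇒T : ∀ {b} → b ≡ true → T b
≡⇒T = Equivalence.from T-≡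

≡⇒T-not : ∀ {b} → b ≡ false → T (not b)
≡⇒T-not = Equivalence.from T-not-≡

eqBool⇒≡ : ∀ {a b} → T (eqBool a b) → a ≡ b
eqBool⇒≡ {true}  t = sym (T⇒≡ t)
eqBool⇒≡ {false} t = sym (T-not⇒≡ t)

eqBool-refl : ∀ a → T (eqBool a a)
eqBool-refl true  = tt
eqBool-refl false = tt

all-applyUpTo : ∀ (p : A → Bool) f n → T (all p (applyUpTo f n)) → ∀ {i} → i < n → T (p (f i))
all-applyUpTo p f (suc n) t {zero}  _   = proj₁ (∧-split {p (f 0)} t)
all-applyUpTo p f (suc n) t {suc i} i<n = all-applyUpTo p (f ∘ suc) n (proj₂ (∧-split {p (f 0)} t)) (s<s⁻¹ i<n)

all-applyUpTo⁺ : ∀ (p : A → Bool) f n → (∀ i → i < n → T (p (f i))) → T (all p (applyUpTo f n))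
all-applyUpTo⁺ p f zero    h = tt
all-applyUpTo⁺ p f (suc n) h = ∧-pair {p (f 0)} (h 0 z<s) (all-applyUpTo⁺ p (f ∘ suc) n λ i i<n → h (suc i) (s<s i<n))

and-zipWith : ∀ (r : A → B → Bool) f g n → T (and (zipWith r (applyUpTo f n) (applyUpTo g n))) →
  ∀ {i} → i < n → T (r (f i) (g i))
and-zipWith r f g (suc n) t {zero}  _   = proj₁ (∧-split {r (f 0) (g 0)} t)
and-zipWith r f g (suc n) t {suc i} i<n =
  and-zipWith r (f ∘ suc) (g ∘ suc) n (proj₂ (∧-split {r (f 0) (g 0)} t)) (s<s⁻¹ i<n)

and-zipWith⁺ : ∀ (r : A → B → Bool) f g n → (∀ i → i < n → T (r (f i) (g i))) →
  T (and (zipWith r (applyUpTo f n) (applyUpTo g n)))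
and-zipWith⁺ r f g zero    h = tt
and-zipWith⁺ r f g (suc n) h =
  ∧-pair {r (f 0) (g 0)} (h 0 z<s) (and-zipWith⁺ r (f ∘ suc) (g ∘ suc) n λ i i<n → h (suc i) (s<s i<n))

-- Words of adjacent transpositions

-- A letter records the two labels being swapped, the left one first, instead of a position, because
-- double crossings concern pairs of pipes. Reducedness is not built in; it is a condition on the
-- list of letters.
data Run : List ℕ → List (ℕ × ℕ) → List ℕ → Set where
  []   : ∀ {L} → Run L [] L
  swap : ∀ xs {a b ys C L} → Run (xs ++ b ∷ a ∷ ys) C L → Run (xs ++ a ∷ b ∷ ys) ((a , b) ∷ C) L

run-++ : ∀ {L M N C D} → Run L C M → Run M D N → Run L (C ++ D) N
run-++ []          s = s
run-++ (swap xs r) s = swap xs (run-++ r s)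

run-∷ : ∀ {L M C} x → Run L C M → Run (x ∷ L) C (x ∷ M)
run-∷ x []          = []
run-∷ x (swap xs r) = swap (x ∷ xs) (run-∷ x r)

run-++ʳ : ∀ {L M C} ws → Run L C M → Run (L ++ ws) C (M ++ ws)
run-++ʳ ws []          = []
run-++ʳ ws (swap xs {a} {b} {ys} {C} {M} r) =
  subst (λ K → Run K ((a , b) ∷ C) (M ++ ws)) (sym (++-assoc xs (a ∷ b ∷ ys) ws))
    (swap xs (subst (λ K → Run K C (M ++ ws)) (++-assoc xs (b ∷ a ∷ ys) ws) (run-++ʳ ws r)))

data Before (x y : ℕ) : List ℕ → Set where
  here  : ∀ {L} → y ∈ L → Before x y (x ∷ L)
  there : ∀ {z L} → Before x y L → Before x y (z ∷ L)

swap-↭ : ∀ (xs : List ℕ) {a b ys} → xs ++ a ∷ b ∷ ys ↭ xs ++ b ∷ a ∷ ys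
swap-↭ xs = ++⁺ˡ xs (↭.swap _ _ ↭-refl)

before-swap : ∀ xs {a b ys x y} → ¬ (x ≡ a × y ≡ b) →
  Before x y (xs ++ a ∷ b ∷ ys) → Before x y (xs ++ b ∷ a ∷ ys)
before-swap []       ne (here (here refl))   = ⊥-elim (ne (refl , refl))
before-swap []       ne (here (there y∈))    = there (here y∈)
before-swap []       ne (there (here y∈))    = here (there y∈)
before-swap []       ne (there (there p))    = there (there p)
before-swap (z ∷ xs) ne (here y∈)            = here (∈-resp-↭ (swap-↭ xs) y∈)
before-swap (z ∷ xs) ne (there p)            = there (before-swap xs ne p)

before-adjacent : ∀ xs {a b ys} → Before a b (xs ++ a ∷ b ∷ ys)
before-adjacent []       = here (here refl)
before-adjacent (x ∷ xs) = there (before-adjacent xs)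

before-applyUpTo : ∀ f n {x y} → Before x y (applyUpTo f n) → ∃₂ λ i j → i < j × j < n × f i ≡ x × f j ≡ y
before-applyUpTo f (suc n) (here y∈) with member f n y∈
  where
  member : ∀ f n {y} → y ∈ applyUpTo (f ∘ suc) n → ∃ λ j → j < n × f (suc j) ≡ y
  member f (suc n) (here refl) = 0 , z<s , refl
  member f (suc n) (there y∈) with member (f ∘ suc) n y∈
  ... | j , j<n , e = suc j , s<s j<n , e
... | j , j<n , e = 0 , suc j , z<s , s<s j<n , refl , e
before-applyUpTo f (suc n) (there p) with before-applyUpTo (f ∘ suc) n p
... | i , j , i<j , j<n , e , e′ = suc i , suc j , s<s i<j , s<s j<n , e , e′

before-∈ : ∀ {x y L} → Before x y L → y ∈ L
before-∈ (here y∈) = there y∈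
before-∈ (there p) = there (before-∈ p)

before-antisym : ∀ {x y L} → Unique L → Before x y L → ¬ Before y x L
before-antisym (x≢ ∷ _) (here y∈)  (here x∈)  = All.lookup x≢ x∈ refl
before-antisym (x≢ ∷ _) (here y∈)  (there q)  = All.lookup x≢ (before-∈ q) refl
before-antisym (y≢ ∷ _) (there p)  (here x∈)  = All.lookup y≢ (before-∈ p) refl
before-antisym (_  ∷ u) (there p)  (there q)  = before-antisym u p q

-- In `AllPairs` the first argument is the earlier letter, so this forbids a swap from being undone
-- later.
Unreversed : ℕ × ℕ → ℕ × ℕ → Set
Unreversed (a , b) (x , y) = ¬ (x ≡ b × y ≡ a)

before-run : ∀ {L C M x y} → Run L C M → All (λ c → ¬ (x ≡ proj₁ c × y ≡ proj₂ c)) C → Before x y L → Before x y M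
before-run []          _        p = p
before-run (swap xs r) (ne ∷ nes) p = before-run r nes (before-swap xs ne p)

-- An earlier letter could have produced the order `x`, `y` only by being `(y , x)`, which
-- `Unreversed` forbids. Likewise nothing later restores the order after the swap, which is
-- `before-end`. Together they show that every letter is a pair whose order differs between the two
-- end words.
before-start : ∀ {L C M} → Run L C M → AllPairs Unreversed C → All (λ (x , y) → Before x y L) C
before-start []          _        = []
before-start (swap xs r) (u ∷ us) = before-adjacent xs ∷
  All.map (λ (v , p) → before-swap xs v p) (All.zip (u , before-start r us))

before-end : ∀ {L C M} → Run L C M → AllPairs Unreversed C → All (λ (x , y) → Before y x M) C
before-end []          _        = []
before-end (swap xs r) (u ∷ us) =
  before-run r (All.map (λ v (e , e′) → v (sym e , sym e′)) u) (before-adjacent xs) ∷ before-end r us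

-- A bumpless pipe dream lists a crossing as (right pipe, left pipe), a pipe dream as (left, right).
orient : Bool → ℕ × ℕ → Label × Label
orient true  (a , b) = just a , just b
orient false (a , b) = just b , just a

-- Repeated crossings as a property of words.

SamePair : ℕ × ℕ → ℕ × ℕ → Set
SamePair (a , b) (x , y) = (a ≡ x × b ≡ y) ⊎ (a ≡ y × b ≡ x)

samePair⇒ : ∀ o p q → T (samePair (orient o p) (orient o q)) → SamePair p q
samePair⇒ true (a , b) (x , y) t with Equivalence.to (T-∨ {(a ≡ᵇ x) ∧ (b ≡ᵇ y)}) t
... | inj₁ s = let u , v = ∧-split {a ≡ᵇ x} s in inj₁ (≡ᵇ⇒≡ a x u , ≡ᵇ⇒≡ b y v)
... | inj₂ s = let u , v = ∧-split {a ≡ᵇ y} s in inj₂ (≡ᵇ⇒≡ a y u , ≡ᵇ⇒≡ b x v)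
samePair⇒ false (a , b) (x , y) t with Equivalence.to (T-∨ {(b ≡ᵇ y) ∧ (a ≡ᵇ x)}) t
... | inj₁ s = let u , v = ∧-split {b ≡ᵇ y} s in inj₁ (≡ᵇ⇒≡ a x v , ≡ᵇ⇒≡ b y u)
... | inj₂ s = let u , v = ∧-split {b ≡ᵇ x} s in inj₂ (≡ᵇ⇒≡ a y v , ≡ᵇ⇒≡ b x u)

samePair⇐ : ∀ o p q → SamePair p q → T (samePair (orient o p) (orient o q))
samePair⇐ true  (a , b) (x , y) (inj₁ (e , e′)) = Equivalence.from (T-∨ {(a ≡ᵇ x) ∧ (b ≡ᵇ y)}) (inj₁ (∧-pair {a ≡ᵇ x} (≡⇒≡ᵇ a x e) (≡⇒≡ᵇ b y e′)))
samePair⇐ true  (a , b) (x , y) (inj₂ (e , e′)) = Equivalence.from (T-∨ {(a ≡ᵇ x) ∧ (b ≡ᵇ y)}) (inj₂ (∧-pair {a ≡ᵇ y} (≡⇒≡ᵇ a y e) (≡⇒≡ᵇ b x e′)))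
samePair⇐ false (a , b) (x , y) (inj₁ (e , e′)) = Equivalence.from (T-∨ {(b ≡ᵇ y) ∧ (a ≡ᵇ x)}) (inj₁ (∧-pair {b ≡ᵇ y} (≡⇒≡ᵇ b y e′) (≡⇒≡ᵇ a x e)))
samePair⇐ false (a , b) (x , y) (inj₂ (e , e′)) = Equivalence.from (T-∨ {(b ≡ᵇ y) ∧ (a ≡ᵇ x)}) (inj₂ (∧-pair {b ≡ᵇ x} (≡⇒≡ᵇ b x e′) (≡⇒≡ᵇ a y e)))

T-not⇒¬ : ∀ {b} → T (not b) → ¬ T b
T-not⇒¬ {false} _ ()

¬⇒T-not : ∀ {b} → ¬ T b → T (not b)
¬⇒T-not {false} _ = tt
¬⇒T-not {true}  h = h tt

Distinct : ℕ × ℕ → ℕ × ℕ → Set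
Distinct p q = ¬ SamePair p q

noRepeat⇒ : ∀ cs → T (noRepeat cs) → AllPairs (λ p q → ¬ T (samePair p q)) cs
noRepeat⇒ []       _ = []
noRepeat⇒ (c ∷ cs) t = let u , v = ∧-split {all (λ q → not (samePair c q)) cs} t in
  All.map T-not⇒¬ (Allₚ.all⁺ _ cs u) ∷ noRepeat⇒ cs v

noRepeat⇐ : ∀ {cs} → AllPairs (λ p q → ¬ T (samePair p q)) cs → T (noRepeat cs)
noRepeat⇐ []       = tt
noRepeat⇐ {c ∷ cs} (u ∷ us) = ∧-pair {all (λ q → not (samePair c q)) cs}
  (Allₚ.all⁻ _ (All.map ¬⇒T-not u)) (noRepeat⇐ us)

eqL-sym : ∀ a b → T (eqL a b) → T (eqL b a)
eqL-sym nothing  nothing  _ = tt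
eqL-sym (just a) (just b) t = ≡⇒≡ᵇ b a (sym (≡ᵇ⇒≡ a b t))

samePair-sym : ∀ p q → T (samePair p q) → T (samePair q p)
samePair-sym (a , b) (c , d) t with Equivalence.to (T-∨ {eqL a c ∧ eqL b d}) t
... | inj₁ s = let u , v = ∧-split {eqL a c} s in
  Equivalence.from (T-∨ {eqL c a ∧ eqL d b}) (inj₁ (∧-pair {eqL c a} (eqL-sym a c u) (eqL-sym b d v)))
... | inj₂ s = let u , v = ∧-split {eqL a d} s in
  Equivalence.from (T-∨ {eqL c a ∧ eqL d b}) (inj₂ (∧-pair {eqL c b} (eqL-sym b c v) (eqL-sym a d u)))

allPairs-resp-↭ : ∀ {A : Set} {R : A → A → Set} → (∀ {x y} → R x y → R y x) →
  ∀ {xs ys} → xs ↭ ys → AllPairs R xs → AllPairs R ys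
allPairs-resp-↭ {A} R-sym p = ↭ₛ.AllPairs-resp-↭ (setoid A) R-sym (resp₂ _) (↭⇒↭ₛ p)

data Trace (o : Bool) (L : List Label) (cs : List (Label × Label)) (M : List Label) : Set where
  trace : ∀ C → Run (catMaybes L) C (catMaybes M) → map (orient o) C ↭ cs → Trace o L cs M

noRepeat⇒distinct : ∀ o C {cs} → map (orient o) C ↭ cs → T (noRepeat cs) → AllPairs Distinct C
noRepeat⇒distinct o C p t = AllPairs.map (λ ne s → ne (samePair⇐ o _ _ s))
  (AllPairsₚ.map⁻ (allPairs-resp-↭ (λ {p} {q} ne s → ne (samePair-sym q p s)) (↭-sym p) (noRepeat⇒ _ t)))

distinct⇒noRepeat : ∀ o C {cs} → map (orient o) C ↭ cs → AllPairs Distinct C → T (noRepeat cs)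
distinct⇒noRepeat o C p d = noRepeat⇐ (allPairs-resp-↭ (λ {p} {q} ne s → ne (samePair-sym q p s)) p
  (AllPairsₚ.map⁺ (AllPairs.map (λ ne s → ne (samePair⇒ o _ _ s)) d)))

trace-refl : ∀ {o L} → Trace o L [] L
trace-refl = trace [] [] ↭-refl

trace-++ : ∀ {o L M N cs ds} → Trace o L cs M → Trace o M ds N → Trace o L (cs ++ ds) N
trace-++ {o} (trace C r p) (trace D s q) = trace (C ++ D) (run-++ r s)
  (subst (_↭ _) (sym (map-++ (orient o) C D)) (++⁺ p q))

trace-↭ : ∀ {o L M cs ds} → cs ↭ ds → Trace o L cs M → Trace o L ds M
trace-↭ q (trace C r p) = trace C r (↭-trans p q)

trace-∷ : ∀ {o L M cs} x → Trace o L cs M → Trace o (x ∷ L) cs (x ∷ M)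
trace-∷ nothing  (trace C r p) = trace C r p
trace-∷ (just x) (trace C r p) = trace C (run-∷ x r) p

trace-++ʳ : ∀ {o L M cs} ws → Trace o L cs M → Trace o (L ++ ws) cs (M ++ ws)
trace-++ʳ {L = L} {M} ws (trace C r p) = trace C
  (subst₂ (λ X Y → Run X C Y) (sym (catMaybes-++ L ws)) (sym (catMaybes-++ M ws)) (run-++ʳ (catMaybes ws) r)) p

trace-swap : ∀ o {a b L} → Trace o (just a ∷ just b ∷ L) (orient o (a , b) ∷ []) (just b ∷ just a ∷ L)
trace-swap o = trace (_ ∷ []) (swap [] []) ↭-refl

-- Words that only exchange a small label with a large one on its right.

module Classes (k : ℕ) where

  small : ℕ → Bool
  small a = a <ᵇ k

  -- Only such crossings occur in a reduced word of an inverse-Grassmannian permutation.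
  Mixed : ℕ × ℕ → Set
  Mixed (a , b) = small a ≡ true × small b ≡ false

  mixed-unreversed : ∀ {C} → All Mixed C → AllPairs Unreversed C
  mixed-unreversed []              = []
  mixed-unreversed ((s , _) ∷ ms) =
    All.map (λ { (_ , l) (refl , refl) → true≢false (trans (sym s) l) }) ms ∷ mixed-unreversed ms
    where
    true≢false : true ≢ false
    true≢false ()

  -- The opposite letter would need one label to be both small and large. The same letter cannot
  -- recur either: after the swap `b` stands before `a`, whereas `before-start` would put `a` before
  -- `b` there.
  mixed-distinct : ∀ {L C M} → Unique L → Run L C M → All Mixed C → AllPairs Distinct C
  mixed-distinct u []          []       = []
  mixed-distinct u (swap xs r) (m ∷ ms) with mixed-unreversed (m ∷ ms)
  ... | v ∷ _ = All.map (λ { (w , p) (inj₁ (refl , refl)) → before-antisym u′ p (before-adjacent xs)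
                           ; (w , p) (inj₂ (refl , refl)) → w (refl , refl) })
                  (All.zip (v , before-start r (mixed-unreversed ms))) ∷ mixed-distinct u′ r ms
    where u′ = allPairs-resp-↭ (λ ne e → ne (sym e)) (swap-↭ xs) u

  keep : Bool → List ℕ → List ℕ
  keep c []       = []
  keep c (x ∷ xs) = if eqBool c (small x) then x ∷ keep c xs else keep c xs

  keep-swap : ∀ c xs {a b ys} → Mixed (a , b) → keep c (xs ++ a ∷ b ∷ ys) ≡ keep c (xs ++ b ∷ a ∷ ys)
  keep-swap true  [] (s , l) rewrite s | l = refl
  keep-swap false [] (s , l) rewrite s | l = refl
  keep-swap c (x ∷ xs) m with eqBool c (small x)
  ... | true  = cong (x ∷_) (keep-swap c xs m)
  ... | false = keep-swap c xs m

  keep-run : ∀ c {L C M} → Run L C M → All Mixed C → keep c L ≡ keep c M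
  keep-run c []          _        = refl
  keep-run c (swap xs r) (m ∷ ms) = trans (keep-swap c xs m) (keep-run c r ms)

  -- The pattern of sizes tells from which of the two subsequences the next entry is taken.
  shuffle-unique : ∀ L M → map small L ≡ map small M → (∀ c → keep c L ≡ keep c M) → L ≡ M
  shuffle-unique []      []      _ _ = refl
  shuffle-unique (x ∷ L) (y ∷ M) e h with small x | small y | ∷-injective e | h true | h false
  ... | true  | _ | refl , e′ | ht | hf = cong₂ _∷_ (∷-injectiveˡ ht)
    (shuffle-unique L M e′ λ { true → ∷-injectiveʳ ht ; false → hf })
  ... | false | _ | refl , e′ | ht | hf = cong₂ _∷_ (∷-injectiveˡ hf)
    (shuffle-unique L M e′ λ { true → ht ; false → ∷-injectiveʳ hf })

-- Tracing bumpless pipe dreams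

outN outE : BTile → Label → Label → Label
outN bcross s w = s
outN bhor   s w = nothing
outN bver   s w = s
outN br     s w = nothing
outN bj     s w = w
outN bblank s w = nothing
outE bcross s w = w
outE bhor   s w = w
outE bver   s w = w
outE br     s w = s
outE bj     s w = nothing
outE bblank s w = nothing

Agrees : BTile → Label → Label → Set
Agrees t s w = is-just s ≡ edgeS t × is-just w ≡ edgeW t

is-just-outN : ∀ t {s w} → Agrees t s w → is-just (outN t s w) ≡ edgeN t
is-just-outN bcross (s , w) = s
is-just-outN bhor   (s , w) = refl
is-just-outN bver   (s , w) = s
is-just-outN br     (s , w) = refl
is-just-outN bj     (s , w) = w
is-just-outN bblank (s , w) = refl

is-just-outE : ∀ t {s w} → Agrees t s w → is-just (outE t s w) ≡ edgeE t
is-just-outE bcross (s , w) = w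
is-just-outE bhor   (s , w) = w
is-just-outE bver   (s , w) = w
is-just-outE br     (s , w) = s
is-just-outE bj     (s , w) = refl
is-just-outE bblank (s , w) = refl

crossAt : BTile → Label → Label → List (Label × Label)
crossAt bcross s w = (s , w) ∷ []
crossAt _      s w = []

crossings : (ℕ → BTile) → (ℕ → Label) → (ℕ → Label) → ℕ → List (Label × Label)
crossings t s W zero    = []
crossings t s W (suc n) = crossAt (t 0) (s 0) (W 0) ++ crossings (t ∘ suc) (s ∘ suc) (W ∘ suc) n

-- The tile rules determine the labels from left to right, so functions obeying them must be what
-- `bRow` computes. This trades the recursion on lists for equations at single positions.
bRow-labels : ∀ n t s W N →
  (∀ j → j < n → W (suc j) ≡ outE (t j) (s j) (W j)) →
  (∀ j → j < n → N j ≡ outN (t j) (s j) (W j)) →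
  bRow (applyUpTo t n) (applyUpTo s n) (W 0) ≡ (applyUpTo N n , W n , crossings t s W n)
bRow-labels zero    t s W N hW hN = refl
bRow-labels (suc n) t s W N hW hN
  with t 0 | hW 0 z<s | hN 0 z<s
     | bRow-labels n (t ∘ suc) (s ∘ suc) (W ∘ suc) (N ∘ suc)
         (λ j j<n → hW (suc j) (s<s j<n)) (λ j j<n → hN (suc j) (s<s j<n))
... | bcross | e | e′ | ih rewrite sym e | e′ | ih = refl
... | bhor   | e | e′ | ih rewrite sym e | e′ | ih = refl
... | bver   | e | e′ | ih rewrite sym e | e′ | ih = refl
... | br     | e | e′ | ih rewrite sym e | e′ | ih = refl
... | bj     | e | e′ | ih rewrite sym e | e′ | ih = refl
... | bblank | e | e′ | ih rewrite sym e | e′ | ih = refl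

module _ (n : ℕ) where

  gridCrossings : (ℕ → ℕ → BTile) → (ℕ → ℕ → Label) → (ℕ → ℕ → Label) → ℕ → List (Label × Label)
  gridCrossings t N W zero    = []
  gridCrossings t N W (suc m) = crossings (t 0) (N 1) (W 0) n ++ gridCrossings (t ∘ suc) (N ∘ suc) (W ∘ suc) m

  bGrid-labels : ∀ m t N W → (∀ i → W i 0 ≡ nothing) →
    (∀ i j → i < m → W i (suc j) ≡ outE (t i j) (N (suc i) j) (W i j)) →
    (∀ i j → i < m → N i j ≡ outN (t i j) (N (suc i) j) (W i j)) →
    bGrid (applyUpTo (λ i → applyUpTo (t i) n) m) (applyUpTo (N m) n)
      ≡ (applyUpTo (N 0) n , applyUpTo (λ i → W i n) m , gridCrossings t N W m)
  bGrid-labels zero    t N W h0 hW hN = refl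
  bGrid-labels (suc m) t N W h0 hW hN
    rewrite bGrid-labels m (t ∘ suc) (N ∘ suc) (W ∘ suc) (h0 ∘ suc)
              (λ i j i<m → hW (suc i) j (s<s i<m)) (λ i j i<m → hN (suc i) j (s<s i<m))
          | sym (h0 0)
          | bRow-labels n (t 0) (N 1) (W 0) (N 0) (λ j _ → hW 0 j z<s) (λ j _ → hN 0 j z<s) = refl

  ∈-crossings : ∀ t s W {j} n → j < n → t j ≡ bcross → (s j , W j) ∈ crossings t s W n
  ∈-crossings t s W {zero}  (suc n) j<n e rewrite e = here refl
  ∈-crossings t s W {suc j} (suc n) j<n e =
    ∈-++⁺ʳ (crossAt (t 0) (s 0) (W 0)) (∈-crossings (t ∘ suc) (s ∘ suc) (W ∘ suc) n (s<s⁻¹ j<n) e)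

  ∈-gridCrossings : ∀ t N W {i j} m → i < m → j < n → t i j ≡ bcross →
    (N (suc i) j , W i j) ∈ gridCrossings t N W m
  ∈-gridCrossings t N W {zero}  (suc m) i<m j<n e = ∈-++⁺ˡ (∈-crossings (t 0) (N 1) (W 0) n j<n e)
  ∈-gridCrossings t N W {suc i} (suc m) i<m j<n e =
    ∈-++⁺ʳ (crossings (t 0) (N 1) (W 0) n) (∈-gridCrossings (t ∘ suc) (N ∘ suc) (W ∘ suc) m (s<s⁻¹ i<m) j<n e)

  all-crossings : ∀ {P : Label × Label → Set} t s W n → (∀ j → j < n → t j ≡ bcross → P (s j , W j)) →
    All P (crossings t s W n)
  all-crossings t s W zero    h = []
  all-crossings {P} t s W (suc n) h = Allₚ.++⁺ (first (t 0) (h 0 z<s))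
    (all-crossings (t ∘ suc) (s ∘ suc) (W ∘ suc) n λ j j<n → h (suc j) (s<s j<n))
    where
    first : ∀ x → (x ≡ bcross → P (s 0 , W 0)) → All P (crossAt x (s 0) (W 0))
    first bcross h = h refl ∷ []
    first bhor   h = []
    first bver   h = []
    first br     h = []
    first bj     h = []
    first bblank h = []

  all-gridCrossings : ∀ {P : Label × Label → Set} t N W m →
    (∀ i j → i < m → j < n → t i j ≡ bcross → P (N (suc i) j , W i j)) → All P (gridCrossings t N W m)
  all-gridCrossings t N W zero    h = []
  all-gridCrossings t N W (suc m) h = Allₚ.++⁺ (all-crossings (t 0) (N 1) (W 0) n λ j → h 0 j z<s)
    (all-gridCrossings (t ∘ suc) (N ∘ suc) (W ∘ suc) m λ i j i<m → h (suc i) j (s<s i<m))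

  -- The frontier first runs along the west and then the south edge of the tile, and afterwards
  -- along the north and then the east edge. Without a crossing at most one pipe meets the tile, so
  -- the word does not change once `nothing` is dropped.
  tile-trace : ∀ t s w L → Agrees t s w →
    Trace false (w ∷ s ∷ L) (crossAt t s w) (outN t s w ∷ outE t s w ∷ L)
  tile-trace bcross (just s) (just w) L (refl , refl) = trace-swap false
  tile-trace bhor   nothing  (just w) L (refl , refl) = trace [] [] ↭-refl
  tile-trace bver   (just s) nothing  L (refl , refl) = trace [] [] ↭-refl
  tile-trace br     (just s) nothing  L (refl , refl) = trace [] [] ↭-refl
  tile-trace bj     nothing  (just w) L (refl , refl) = trace [] [] ↭-refl
  tile-trace bblank nothing  nothing  L (refl , refl) = trace [] [] ↭-refl

  row-trace : ∀ n t s W N →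
    (∀ j → j < n → W (suc j) ≡ outE (t j) (s j) (W j)) →
    (∀ j → j < n → N j ≡ outN (t j) (s j) (W j)) →
    (∀ j → j < n → Agrees (t j) (s j) (W j)) →
    Trace false (W 0 ∷ applyUpTo s n) (crossings t s W n) (applyUpTo N n ++ W n ∷ [])
  row-trace zero    t s W N hW hN ag = trace [] [] ↭-refl
  row-trace (suc n) t s W N hW hN ag = trace-++
    (subst₂ (λ x y → Trace false (W 0 ∷ s 0 ∷ applyUpTo (s ∘ suc) n) (crossAt (t 0) (s 0) (W 0)) (x ∷ y ∷ applyUpTo (s ∘ suc) n))
      (sym (hN 0 z<s)) (sym (hW 0 z<s)) (tile-trace (t 0) (s 0) (W 0) _ (ag 0 z<s)))
    (trace-∷ (N 0) (row-trace n (t ∘ suc) (s ∘ suc) (W ∘ suc) (N ∘ suc)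
      (λ j j<n → hW (suc j) (s<s j<n)) (λ j j<n → hN (suc j) (s<s j<n)) (λ j j<n → ag (suc j) (s<s j<n))))

  -- Lower rows are swept first. Their exits wait at the right end of the frontier while the higher
  -- rows are swept, which leaves the exits in order from top to bottom.
  grid-trace : ∀ m t N W → (∀ i → W i 0 ≡ nothing) →
    (∀ i j → i < m → W i (suc j) ≡ outE (t i j) (N (suc i) j) (W i j)) →
    (∀ i j → i < m → N i j ≡ outN (t i j) (N (suc i) j) (W i j)) →
    (∀ i j → i < m → j < n → Agrees (t i j) (N (suc i) j) (W i j)) →
    Trace false (applyUpTo (N m) n) (gridCrossings t N W m) (applyUpTo (N 0) n ++ applyUpTo (λ i → W i n) m)
  grid-trace zero    t N W h0 hW hN ag = subst (Trace false _ []) (sym (++-identityʳ _)) trace-refl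
  grid-trace (suc m) t N W h0 hW hN ag = trace-↭ (++-comm _ (crossings (t 0) (N 1) (W 0) n)) (trace-++
    (grid-trace m (t ∘ suc) (N ∘ suc) (W ∘ suc) (h0 ∘ suc)
      (λ i j i<m → hW (suc i) j (s<s i<m)) (λ i j i<m → hN (suc i) j (s<s i<m)) (λ i j i<m → ag (suc i) j (s<s i<m)))
    (subst (Trace false _ _) (++-assoc (applyUpTo (N 0) n) _ _) (trace-++ʳ (applyUpTo (λ i → W (suc i) n) m) row)))
    where
    row : Trace false (applyUpTo (N 1) n) (crossings (t 0) (N 1) (W 0) n) (applyUpTo (N 0) n ++ W 0 n ∷ [])
    row with row-trace n (t 0) (N 1) (W 0) (N 0) (λ j _ → hW 0 j z<s) (λ j _ → hN 0 j z<s) (λ j → ag 0 j z<s)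
    -- The west border contributes a leading `nothing`, which the word drops.
    ... | r rewrite h0 0 with r
    ...   | trace C q p = trace C q p

-- Matching of edges in the shape test for bumpless pipe dreams.

rowRest⇒ : ∀ u n (t : ℕ → BTile) (H : ℕ → Bool) → T (rowRest u (applyUpTo t n)) → H 0 ≡ edgeE u →
  (∀ j → j < n → edgeW (t j) ≡ H j → H (suc j) ≡ edgeE (t j)) →
  (∀ j → j < n → edgeW (t j) ≡ H j) × H n ≡ true
rowRest⇒ u zero    t H ok h0 hs = (λ _ ()) , trans h0 (T⇒≡ ok)
rowRest⇒ u (suc n) t H ok h0 hs = every , proj₂ ih
  where
  parts = ∧-split {eqBool (edgeE u) (edgeW (t 0))} ok
  first : edgeW (t 0) ≡ H 0
  first = trans (sym (eqBool⇒≡ (proj₁ parts))) (sym h0)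
  ih = rowRest⇒ (t 0) n (t ∘ suc) (H ∘ suc) (proj₂ parts) (hs 0 z<s first) (λ j j<n → hs (suc j) (s<s j<n))
  every : ∀ j → j < suc n → edgeW (t j) ≡ H j
  every zero    _   = first
  every (suc j) j<n = proj₁ ih j (s<s⁻¹ j<n)

-- `H` stands for the presence of labels, which follows a tile only if the tile receives the labels
-- it expects; hence the conditional hypothesis and the induction from the west border. An empty row
-- passes the test with `H 0 ≡ false`, so `n` has to be positive.
rowOK⇒ : ∀ n (t : ℕ → BTile) (H : ℕ → Bool) → 0 < n → T (rowOK (applyUpTo t n)) → H 0 ≡ false →
  (∀ j → j < n → edgeW (t j) ≡ H j → H (suc j) ≡ edgeE (t j)) →
  (∀ j → j < n → edgeW (t j) ≡ H j) × H n ≡ true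
rowOK⇒ (suc n) t H _ ok h0 hs = every , proj₂ ih
  where
  parts = ∧-split {not (edgeW (t 0))} ok
  first : edgeW (t 0) ≡ H 0
  first = trans (T-not⇒≡ (proj₁ parts)) (sym h0)
  ih = rowRest⇒ (t 0) n (t ∘ suc) (H ∘ suc) (proj₂ parts) (hs 0 z<s first) (λ j j<n → hs (suc j) (s<s j<n))
  every : ∀ j → j < suc n → edgeW (t j) ≡ H j
  every zero    _   = first
  every (suc j) j<n = proj₁ ih j (s<s⁻¹ j<n)

rowRest⇐ : ∀ u n (t : ℕ → BTile) (H : ℕ → Bool) → H 0 ≡ edgeE u → (∀ j → j < n → edgeW (t j) ≡ H j) →
  (∀ j → j < n → edgeE (t j) ≡ H (suc j)) → H n ≡ true → T (rowRest u (applyUpTo t n))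
rowRest⇐ u zero    t H h0 hW hE hn = ≡⇒T (trans (sym h0) hn)
rowRest⇐ u (suc n) t H h0 hW hE hn = ∧-pair
  (subst (λ b → T (eqBool (edgeE u) b)) (trans (sym h0) (sym (hW 0 z<s))) (eqBool-refl (edgeE u)))
  (rowRest⇐ (t 0) n (t ∘ suc) (H ∘ suc) (sym (hE 0 z<s)) (λ j j<n → hW (suc j) (s<s j<n)) (λ j j<n → hE (suc j) (s<s j<n)) hn)

rowOK⇐ : ∀ n (t : ℕ → BTile) (H : ℕ → Bool) → H 0 ≡ false → (∀ j → j < n → edgeW (t j) ≡ H j) →
  (∀ j → j < n → edgeE (t j) ≡ H (suc j)) → H n ≡ true → T (rowOK (applyUpTo t n))
rowOK⇐ zero    t H h0 hW hE hn = tt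
rowOK⇐ (suc n) t H h0 hW hE hn = ∧-pair (≡⇒T-not (trans (hW 0 z<s) h0))
  (rowRest⇐ (t 0) n (t ∘ suc) (H ∘ suc) (sym (hE 0 z<s)) (λ j j<n → hW (suc j) (s<s j<n)) (λ j j<n → hE (suc j) (s<s j<n)) hn)

module _ (n : ℕ) where

  -- Labels enter from the south, so agreement spreads from the bottom row upwards. It does so a
  -- whole row at a time, because the label arriving from the west depends on all tiles further left
  -- in the row.
  vertRest⇒ : ∀ (r : ℕ → BTile) m (t : ℕ → ℕ → BTile) (V : ℕ → ℕ → Bool) → T (vertRest (applyUpTo r n) (applyUpTo (λ i → applyUpTo (t i) n) m)) →
    (∀ j → j < n → V m j ≡ true) →
    (∀ i → i < m → (∀ j → j < n → edgeS (t i j) ≡ V (suc i) j) → ∀ j → j < n → V i j ≡ edgeN (t i j)) →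
    (∀ j → j < n → edgeS (r j) ≡ V 0 j) × (∀ i j → i < m → j < n → edgeS (t i j) ≡ V (suc i) j)
  vertRest⇒ r zero    t V ok hb hs =
    (λ j j<n → trans (T⇒≡ (all-applyUpTo edgeS r n ok j<n)) (sym (hb j j<n))) , (λ i j ())
  vertRest⇒ r (suc m) t V ok hb hs =
    (λ j j<n → trans (eqBool⇒≡ (and-zipWith _ r (t 0) n (proj₁ parts) j<n)) (sym (hs 0 z<s (proj₁ ih) j j<n))) , every
    where
    parts = ∧-split {and (zipWith (λ a b → eqBool (edgeS a) (edgeN b)) (applyUpTo r n) (applyUpTo (t 0) n))} ok
    ih = vertRest⇒ (t 0) m (t ∘ suc) (V ∘ suc) (proj₂ parts) hb (λ i i<m → hs (suc i) (s<s i<m))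
    every : ∀ i j → i < suc m → j < n → edgeS (t i j) ≡ V (suc i) j
    every zero    j _   j<n = proj₁ ih j j<n
    every (suc i) j i<m j<n = proj₂ ih i j (s<s⁻¹ i<m) j<n

  vertRest⇐ : ∀ (r : ℕ → BTile) m (t : ℕ → ℕ → BTile) (V : ℕ → ℕ → Bool) → (∀ j → j < n → edgeS (r j) ≡ V 0 j) → (∀ j → j < n → V m j ≡ true) →
    (∀ i j → i < m → j < n → edgeN (t i j) ≡ V i j) → (∀ i j → i < m → j < n → edgeS (t i j) ≡ V (suc i) j) →
    T (vertRest (applyUpTo r n) (applyUpTo (λ i → applyUpTo (t i) n) m))
  vertRest⇐ r zero    t V h0 hb hN hS = all-applyUpTo⁺ edgeS r n λ j j<n → ≡⇒T (trans (h0 j j<n) (hb j j<n))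
  vertRest⇐ r (suc m) t V h0 hb hN hS = ∧-pair
    (and-zipWith⁺ _ r (t 0) n λ j j<n →
      subst (λ b → T (eqBool (edgeS (r j)) b)) (trans (h0 j j<n) (sym (hN 0 j z<s j<n))) (eqBool-refl (edgeS (r j))))
    (vertRest⇐ (t 0) m (t ∘ suc) (V ∘ suc) (λ j → hS 0 j z<s) hb
      (λ i j i<m → hN (suc i) j (s<s i<m)) (λ i j i<m → hS (suc i) j (s<s i<m)))

  colsOK⇒ : ∀ m (t : ℕ → ℕ → BTile) (V : ℕ → ℕ → Bool) → 0 < m →
    T (colsOK (applyUpTo (λ i → applyUpTo (t i) n) m)) → (∀ j → j < n → V m j ≡ true) →
    (∀ i → i < m → (∀ j → j < n → edgeS (t i j) ≡ V (suc i) j) → ∀ j → j < n → V i j ≡ edgeN (t i j)) →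
    (∀ i j → i < m → j < n → edgeS (t i j) ≡ V (suc i) j) × (∀ j → j < n → V 0 j ≡ false)
  colsOK⇒ (suc m) t V _ ok hb hs = every , λ j j<n → trans (hs 0 z<s (proj₁ ih) j j<n)
    (T-not⇒≡ (all-applyUpTo (λ x → not (edgeN x)) (t 0) n (proj₁ parts) j<n))
    where
    parts = ∧-split {all (λ x → not (edgeN x)) (applyUpTo (t 0) n)} ok
    ih = vertRest⇒ (t 0) m (t ∘ suc) (V ∘ suc) (proj₂ parts) hb (λ i i<m → hs (suc i) (s<s i<m))
    every : ∀ i j → i < suc m → j < n → edgeS (t i j) ≡ V (suc i) j
    every zero    j _   j<n = proj₁ ih j j<n
    every (suc i) j i<m j<n = proj₂ ih i j (s<s⁻¹ i<m) j<n

  colsOK⇐ : ∀ m (t : ℕ → ℕ → BTile) (V : ℕ → ℕ → Bool) → (∀ j → j < n → V m j ≡ true) →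
    (∀ j → j < n → V 0 j ≡ false) →
    (∀ i j → i < m → j < n → edgeN (t i j) ≡ V i j) → (∀ i j → i < m → j < n → edgeS (t i j) ≡ V (suc i) j) →
    T (colsOK (applyUpTo (λ i → applyUpTo (t i) n) m))
  colsOK⇐ zero    t V hb h0 hN hS = tt
  colsOK⇐ (suc m) t V hb h0 hN hS = ∧-pair
    (all-applyUpTo⁺ (λ x → not (edgeN x)) (t 0) n λ j j<n → ≡⇒T-not (trans (hN 0 j z<s j<n) (h0 j j<n)))
    (vertRest⇐ (t 0) m (t ∘ suc) (V ∘ suc) (λ j → hS 0 j z<s) hb
      (λ i j i<m → hN (suc i) j (s<s i<m)) (λ i j i<m → hS (suc i) j (s<s i<m)))

-- Tracing pipe dreams

-- Columns of pipe dreams are numbered from the right, the direction in which the rows are traced.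
outS outW : PTile → Label → Label → Label
outS pcross nl e = nl
outS pelbow nl e = e
outW pcross nl e = e
outW pelbow nl e = nl

east : (ℕ → PTile) → (ℕ → Label) → ℕ → Label
east x nl zero    = nothing
east x nl (suc d) = outW (x d) (nl d) (east x nl d)

south : (ℕ → PTile) → (ℕ → Label) → ℕ → Label
south x nl d = outS (x d) (nl d) (east x nl d)

pCrossAt : PTile → Label → Label → List (Label × Label)
pCrossAt pcross nl e = (nl , e) ∷ []
pCrossAt pelbow nl e = []

pCrossings : (ℕ → PTile) → (ℕ → Label) → ℕ → List (Label × Label)
pCrossings x nl zero    = []
pCrossings x nl (suc d) = pCrossAt (x d) (nl d) (east x nl d) ++ pCrossings x nl d

pRow-labels : ∀ x nl n → pRow (applyDownFrom x n) (applyDownFrom nl n) nothing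
  ≡ (applyDownFrom (south x nl) n , east x nl n , pCrossings x nl n)
pRow-labels x nl zero    = refl
pRow-labels x nl (suc n) rewrite pRow-labels x nl n with x n
... | pcross = refl
... | pelbow = refl

-- From left to right the frontier consists of the north labels still to be read, the label
-- travelling west and the south labels already produced. An elbow sends the north label west and
-- the travelling one south, which leaves this list as it is; a cross swaps the two.
pRow-trace : ∀ x nl n → (∀ d → d < n → x d ≡ pcross → is-just (nl d) ≡ true × is-just (east x nl d) ≡ true) →
  Trace true (applyDownFrom nl n) (pCrossings x nl n) (east x nl n ∷ applyDownFrom (south x nl) n)
pRow-trace x nl zero    h = trace [] [] ↭-refl
pRow-trace x nl (suc n) h = trace-↭ (++-comm (pCrossings x nl n) (pCrossAt (x n) (nl n) (east x nl n))) (trace-++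
  (trace-∷ (nl n) (pRow-trace x nl n λ d d<n → h d (m<n⇒m<1+n d<n)))
  (last (x n) (nl n) (east x nl n) (h n (n<1+n n))))
  where
  last : ∀ {L} x nl e → (x ≡ pcross → is-just nl ≡ true × is-just e ≡ true) →
    Trace true (nl ∷ e ∷ L) (pCrossAt x nl e) (outW x nl e ∷ outS x nl e ∷ L)
  last pelbow nl       e        h = trace-refl
  last pcross (just _) (just _) h = trace-swap true
  last pcross nothing  e        h with () ← proj₁ (h refl)
  last pcross (just _) nothing  h with () ← proj₂ (h refl)

∈-pCrossings : ∀ x nl {d} n → d < n → x d ≡ pcross → (nl d , east x nl d) ∈ pCrossings x nl n
∈-pCrossings x nl {d} (suc n) d<n e with m≤n⇒m<n∨m≡n (s≤s⁻¹ d<n)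
... | inj₁ d<n′ = ∈-++⁺ʳ (pCrossAt (x n) (nl n) (east x nl n)) (∈-pCrossings x nl n d<n′ e)
... | inj₂ refl rewrite e = here refl

all-pCrossings : ∀ {P : Label × Label → Set} x nl n → (∀ d → d < n → x d ≡ pcross → P (nl d , east x nl d)) →
  All P (pCrossings x nl n)
all-pCrossings x nl zero    h = []
all-pCrossings {P} x nl (suc n) h = Allₚ.++⁺ (first (x n) (h n (n<1+n n)))
  (all-pCrossings x nl n λ d d<n → h d (m<n⇒m<1+n d<n))
  where
  first : ∀ y → (y ≡ pcross → P (nl n , east x nl n)) → All P (pCrossAt y (nl n) (east x nl n))
  first pcross h = h refl ∷ []
  first pelbow h = []

module _ (n : ℕ) where

  pGridCrossings : (ℕ → ℕ → PTile) → (ℕ → ℕ → Label) → ℕ → List (Label × Label)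
  pGridCrossings X N zero    = []
  pGridCrossings X N (suc m) = pCrossings (X 0) (N 0) n ++ pGridCrossings (X ∘ suc) (N ∘ suc) m

  pGrid-labels : ∀ m X N → (∀ i d → N (suc i) d ≡ south (X i) (N i) d) →
    pGrid (applyUpTo (λ i → applyDownFrom (X i) n) m) (applyDownFrom (N 0) n)
      ≡ (applyUpTo (λ i → east (X i) (N i) n) m , pGridCrossings X N m)
  pGrid-labels zero    X N hN = refl
  pGrid-labels (suc m) X N hN
    rewrite pRow-labels (X 0) (N 0) n
          | sym (applyDownFrom-cong n (λ d _ → hN 0 d))
          | pGrid-labels m (X ∘ suc) (N ∘ suc) (hN ∘ suc) = refl

  pGrid-trace : ∀ m X N → (∀ i d → N (suc i) d ≡ south (X i) (N i) d) →
    (∀ i d → i < m → d < n → X i d ≡ pcross → is-just (N i d) ≡ true × is-just (east (X i) (N i) d) ≡ true) →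
    Trace true (applyDownFrom (N 0) n) (pGridCrossings X N m)
      (applyUpTo (λ i → east (X i) (N i) n) m ++ applyDownFrom (N m) n)
  pGrid-trace zero    X N hN h = trace-refl
  pGrid-trace (suc m) X N hN h = trace-++
    (subst (λ L → Trace true _ (pCrossings (X 0) (N 0) n) (east (X 0) (N 0) n ∷ L)) (sym (applyDownFrom-cong n λ d _ → hN 0 d))
      (pRow-trace (X 0) (N 0) n λ d → h 0 d z<s))
    (trace-∷ _ (pGrid-trace m (X ∘ suc) (N ∘ suc) (hN ∘ suc) λ i d i<m → h (suc i) d (s<s i<m)))

  ∈-pGridCrossings : ∀ X N {i d} m → i < m → d < n → X i d ≡ pcross →
    (N i d , east (X i) (N i) d) ∈ pGridCrossings X N m
  ∈-pGridCrossings X N {zero}  (suc m) i<m d<n e = ∈-++⁺ˡ (∈-pCrossings (X 0) (N 0) n d<n e)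
  ∈-pGridCrossings X N {suc i} (suc m) i<m d<n e =
    ∈-++⁺ʳ (pCrossings (X 0) (N 0) n) (∈-pGridCrossings (X ∘ suc) (N ∘ suc) m (s<s⁻¹ i<m) d<n e)

  all-pGridCrossings : ∀ {P : Label × Label → Set} X N m →
    (∀ i d → i < m → d < n → X i d ≡ pcross → P (N i d , east (X i) (N i) d)) → All P (pGridCrossings X N m)
  all-pGridCrossings X N zero    h = []
  all-pGridCrossings X N (suc m) h = Allₚ.++⁺ (all-pCrossings (X 0) (N 0) n λ d → h 0 d z<s)
    (all-pGridCrossings (X ∘ suc) (N ∘ suc) m λ i d i<m → h (suc i) d (s<s i<m))

-- The triangular shape of pipe dreams.

all-false : ∀ {A : Set} (p : A → Bool) xs → all p xs ≡ false → ∃ λ x → p x ≡ false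
all-false p (x ∷ xs) e with p x in eq
... | false = x , eq
... | true  = all-false p xs e

all-allFin : ∀ {n} (p : Fin n → Bool) → T (all p (allFin n)) → ∀ i → T (p i)
all-allFin p t = Allₚ.tabulate⁻ (Allₚ.all⁺ p _ t)

pdShape⇒ : ∀ {n} (D : PGrid n) → T (pdShape D) → ∀ i j → at D (toℕ i) (toℕ j) ≡ just pcross →
  T (not ((n ∸ 1) ≤ᵇ (toℕ i + toℕ j)))
pdShape⇒ {n} D t i j e with all-allFin {n} _ t i
... | row with all-allFin {n} _ row j
...   | ok with at D (toℕ i) (toℕ j) | e | ok
...     | _ | refl | ok′ = ok′

pdShape⇐ : ∀ {n} (D : PGrid n) → (∀ i j → at D (toℕ i) (toℕ j) ≡ just pcross →
  T (not ((n ∸ 1) ≤ᵇ (toℕ i + toℕ j)))) → T (pdShape D)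
pdShape⇐ {n} D h with pdShape D in eq
... | true  = tt
... | false with all-false _ (allFin n) eq
...   | i , e with all-false _ (allFin n) e
...     | j , e′ with at D (toℕ i) (toℕ j) | h i j | e′
...       | just pcross | h′ | e″ = subst T e″ (h′ refl)
...       | just pelbow | h′ | ()
...       | nothing     | h′ | ()

-- Edge configurations and their moves

-- Which of the west, north, south and east edges of a tile are used; there is no crossing.
data Cell : Bool → Bool → Bool → Bool → Set where
  blank : Cell false false false false
  elbow : Cell false false true  true
  down  : Cell false true  true  false
  flat  : Cell true  false false true
  jay   : Cell true  true  false false

-- Three edges suffice, because as many pipes enter from the west and south as leave to the north
-- and east. The two patterns violating this balance, `true false true` and `false true false`, get
-- arbitrary tiles.
tileOf : Bool → Bool → Bool → BTile
tileOf true  true  true  = bcross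
tileOf true  false _     = bhor
tileOf false true  _     = bver
tileOf false false true  = br
tileOf true  true  false = bj
tileOf false false false = bblank

cell-S : ∀ {W N S E} → Cell W N S E → edgeS (tileOf W N S) ≡ S
cell-S blank = refl
cell-S elbow = refl
cell-S down  = refl
cell-S flat  = refl
cell-S jay   = refl

cell-W : ∀ {W N S E} → Cell W N S E → edgeW (tileOf W N S) ≡ W
cell-W blank = refl
cell-W elbow = refl
cell-W down  = refl
cell-W flat  = refl
cell-W jay   = refl

cell-N : ∀ {W N S E} → Cell W N S E → edgeN (tileOf W N S) ≡ N
cell-N blank = refl
cell-N elbow = refl
cell-N down  = refl
cell-N flat  = refl
cell-N jay   = refl

cell-E : ∀ {W N S E} → Cell W N S E → edgeE (tileOf W N S) ≡ E
cell-E blank = refl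
cell-E elbow = refl
cell-E down  = refl
cell-E flat  = refl
cell-E jay   = refl

cell-determined : ∀ {W N S E S′ E′} → Cell W N S E → Cell W N S′ E′ →
  isBlank (tileOf W N S) ≡ isBlank (tileOf W N S′) → S ≡ S′ × E ≡ E′
cell-determined blank blank _ = refl , refl
cell-determined elbow elbow _ = refl , refl
cell-determined down  down  _ = refl , refl
cell-determined flat  flat  _ = refl , refl
cell-determined jay   jay   _ = refl , refl

module _ {W N S E : Bool} where

  down-out : Cell W N S E → W ≡ false → N ≡ true → S ≡ true × E ≡ false
  down-out down refl refl = refl , refl

  north-unused : Cell W N S E → N ≡ false → S ≡ false ⊎ E ≡ true
  north-unused blank _ = inj₁ refl
  north-unused elbow _ = inj₂ refl
  north-unused flat  _ = inj₁ refl

  west-used : Cell W N S E → W ≡ true → S ≡ false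
  west-used flat _ = refl
  west-used jay  _ = refl

  elbow-edges : Cell W N S E → tileOf W N S ≡ br → (W ≡ false × N ≡ false) × (S ≡ true × E ≡ true)
  elbow-edges elbow _ = (refl , refl) , (refl , refl)

  blank-edges : Cell W N S E → isBlank (tileOf W N S) ≡ true → (W ≡ false × N ≡ false) × (S ≡ false × E ≡ false)
  blank-edges blank _ = (refl , refl) , (refl , refl)

  nonblank-S : Cell W N S E → isBlank (tileOf W N S) ≡ false → S ≡ false → W ≡ true
  nonblank-S flat _ _ = refl
  nonblank-S jay  _ _ = refl

  nonblank-E : Cell W N S E → isBlank (tileOf W N S) ≡ false → E ≡ false → N ≡ true
  nonblank-E down _ _ = refl
  nonblank-E jay  _ _ = refl

  out-both : Cell W N S E → S ≡ true → E ≡ true → tileOf W N S ≡ br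
  out-both elbow _ _ = refl

data View (i : ℕ) : ℕ → Set where
  same  : View i i
  next  : View i (suc i)
  other : ∀ {a} → (a ≡ᵇ i) ≡ false → (a ≡ᵇ suc i) ≡ false → View i a

≡ᵇ-refl : ∀ i → (i ≡ᵇ i) ≡ true
≡ᵇ-refl zero    = refl
≡ᵇ-refl (suc i) = ≡ᵇ-refl i

≡ᵇ-suc : ∀ i → (i ≡ᵇ suc i) ≡ false
≡ᵇ-suc zero    = refl
≡ᵇ-suc (suc i) = ≡ᵇ-suc i

suc-≡ᵇ : ∀ i → (suc i ≡ᵇ i) ≡ false
suc-≡ᵇ zero    = refl
suc-≡ᵇ (suc i) = suc-≡ᵇ i

≢⇒≡ᵇ : ∀ {a b} → a ≢ b → (a ≡ᵇ b) ≡ false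
≢⇒≡ᵇ {a} {b} a≢b with a ≡ᵇ b in eq
... | true  = ⊥-elim (a≢b (≡ᵇ⇒≡ a b (≡⇒T eq)))
... | false = refl

+-≡ᵇ : ∀ m a b → (m + a ≡ᵇ m + b) ≡ (a ≡ᵇ b)
+-≡ᵇ zero    a b = refl
+-≡ᵇ (suc m) a b = +-≡ᵇ m a b

view : ∀ i a → View i a
view i a with a ≟ i | a ≟ suc i
... | yes refl | _        = same
... | no _     | yes refl = next
... | no a≢i   | no a≢1+i = other (≢⇒≡ᵇ a≢i) (≢⇒≡ᵇ a≢1+i)

<ᵇ-true : ∀ {a b} → a < b → (a <ᵇ b) ≡ true
<ᵇ-true a<b = T⇒≡ (<⇒<ᵇ a<b)

<ᵇ-false : ∀ {a b} → b ≤ a → (a <ᵇ b) ≡ false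
<ᵇ-false {a} {b} b≤a with a <ᵇ b in eq
... | true  = ⊥-elim (<⇒≱ (<ᵇ⇒< a b (≡⇒T eq)) b≤a)
... | false = refl

<ᵇ-true⁻ : ∀ {a b} → (a <ᵇ b) ≡ true → a < b
<ᵇ-true⁻ {a} {b} e = <ᵇ⇒< a b (≡⇒T e)

<ᵇ-false⁻ : ∀ {a b} → (a <ᵇ b) ≡ false → b ≤ a
<ᵇ-false⁻ {a} {b} e with a <? b
... | yes a<b with () ← trans (sym e) (<ᵇ-true a<b)
... | no  a≮b = ≮⇒≥ a≮b

-- The edges V i d above and H i d to the left of cell (i , d).  The columns d < m are filled with
-- vertical pipes: they are no part of the bumpless pipe dream, but they make Config the natural
-- encoding of a pipe dream read from right to left.
record Config (n m : ℕ) (s : ℕ → Bool) : Set where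
  field
    V H    : ℕ → ℕ → Bool
    top    : ∀ {d} → d < n → V 0 d ≡ (d <ᵇ m)
    left   : ∀ {i} → i < n → H i 0 ≡ false
    bottom : ∀ {d} → d < n → V n d ≡ true
    right  : ∀ {i} → i < n → H i n ≡ s i
    cell   : ∀ {i d} → i < n → d < n → Cell (H i d) (V i d) (V (suc i) d) (H i (suc d))

  tl : ℕ → ℕ → BTile
  tl i d = tileOf (H i d) (V i d) (V (suc i) d)

open Config

SameEdges : ∀ {n m s} → Config n m s → Config n m s → Set
SameEdges {n} C D = (∀ {i d} → i ≤ n → d < n → V C i d ≡ V D i d) × (∀ {i d} → i < n → d ≤ n → H C i d ≡ H D i d)

module _ {n m : ℕ} {s : ℕ → Bool} (C D : Config n m s) where

  blanks-determine : (∀ {i d} → i < n → d < n → isBlank (tl C i d) ≡ isBlank (tl D i d)) → SameEdges C D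
  blanks-determine e = (λ {i} i≤n → eqV i i≤n) , λ {i} i<n d≤n → eqH i i<n (eqV i (<⇒≤ i<n)) _ d≤n
    where
    step : ∀ {i d} → i < n → d < n → V C i d ≡ V D i d → H C i d ≡ H D i d →
      V C (suc i) d ≡ V D (suc i) d × H C i (suc d) ≡ H D i (suc d)
    step {i} {d} i<n d<n v h with cell C i<n d<n | cell D i<n d<n | e i<n d<n
    ... | c | c′ | e′ rewrite v | h = cell-determined c c′ e′

    eqH : ∀ i → i < n → (∀ {d} → d < n → V C i d ≡ V D i d) → ∀ d → d ≤ n → H C i d ≡ H D i d
    eqH i i<n v zero    _   = trans (left C i<n) (sym (left D i<n))
    eqH i i<n v (suc d) d<n = proj₂ (step i<n d<n (v d<n) (eqH i i<n v d (<⇒≤ d<n)))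

    eqV : ∀ i → i ≤ n → ∀ {d} → d < n → V C i d ≡ V D i d
    eqV zero    _   d<n = trans (top C d<n) (sym (top D d<n))
    eqV (suc i) i<n {d} d<n = proj₁ (step i<n d<n (eqV i (<⇒≤ i<n) d<n) (eqH i i<n (eqV i (<⇒≤ i<n)) d (<⇒≤ d<n)))

  same-tiles : SameEdges C D → ∀ {i d} → i < n → d < n → tl C i d ≡ tl D i d
  same-tiles (v , h) i<n d<n
    rewrite v (<⇒≤ i<n) d<n | v i<n d<n | h i<n (<⇒≤ d<n) = refl

module _ {n m : ℕ} {s : ℕ → Bool} (C : Config n m s) where

  padding : m ≤ n → ∀ {i} → i ≤ n → (∀ {d} → d < m → V C i d ≡ true) × (i < n → ∀ d → d ≤ m → H C i d ≡ false)
  padding m≤n {i} i≤n = pV i i≤n , λ i<n → pH i i<n (pV i i≤n)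
    where
    step : ∀ {i d} → i < n → d < n → H C i d ≡ false → V C i d ≡ true → V C (suc i) d ≡ true × H C i (suc d) ≡ false
    step i<n d<n = down-out (cell C i<n d<n)
    pH : ∀ i → i < n → (∀ {d} → d < m → V C i d ≡ true) → ∀ d → d ≤ m → H C i d ≡ false
    pH i i<n v zero    _   = left C i<n
    pH i i<n v (suc d) d<m = proj₂ (step i<n (≤-trans d<m m≤n) (pH i i<n v d (<⇒≤ d<m)) (v d<m))
    pV : ∀ i → i ≤ n → ∀ {d} → d < m → V C i d ≡ true
    pV zero    _   d<m = trans (top C (≤-trans d<m m≤n)) (<ᵇ-true d<m)
    pV (suc i) i<n d<m = proj₁ (step i<n (≤-trans d<m m≤n) (pH i i<n (pV i (<⇒≤ i<n)) _ (<⇒≤ d<m)) (pV i (<⇒≤ i<n) d<m))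

  -- Going down, an unused vertical edge is followed by one straight below or diagonally below to the right, and
  -- the path can only leave the grid on the right because all bottom edges are used.
  unused-below-diagonal : ∀ {i d} → i ≤ n → d < n → V C i d ≡ false → i ≤ d
  unused-below-diagonal i≤n = go _ _ (m∸n+n≡m i≤n)
    where
    go : ∀ u i {d} → u + i ≡ n → d < n → V C i d ≡ false → i ≤ d
    go zero    i refl d<n v with () ← trans (sym v) (bottom C d<n)
    go (suc u) i {d} e d<n v with north-unused (cell C i<n d<n) v
      where
      i<n : i < n
      i<n = subst (suc i ≤_) e (s≤s (m≤n+m i u))
    ... | inj₁ v′ = ≤-trans (n≤1+n i) (go u (suc i) (trans (+-suc u i) e) d<n v′)
    ... | inj₂ h with m≤n⇒m<n∨m≡n d<n
    ...   | inj₂ refl = s≤s⁻¹ (subst (suc i ≤_) e (s≤s (m≤n+m i u)))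
    ...   | inj₁ d′<n = s≤s⁻¹ (go u (suc i) (trans (+-suc u i) e) d′<n
      (west-used (cell C (subst (suc i ≤_) e (s≤s (m≤n+m i u))) d′<n) h))

  record Movable (i d : ℕ) : Set where
    field
      i<  : suc i < n
      d<  : suc d < n
      h₀  : H C i d ≡ false
      v₀  : V C i d ≡ false
      v₁  : V C (suc i) d ≡ true
      h₁  : H C i (suc d) ≡ true
      h₂  : H C (suc i) (suc d) ≡ false
      v₂  : V C (suc i) (suc d) ≡ false
      v₃  : V C (suc (suc i)) (suc d) ≡ false
      h₃  : H C (suc i) (suc (suc d)) ≡ false

  movable : ∀ {i d} → suc i < n → suc d < n → tl C i d ≡ br → isBlank (tl C (suc i) (suc d)) ≡ true → Movable i d
  movable i< d< t t′ with elbow-edges (cell C (<⇒≤ i<) (<⇒≤ d<)) t | blank-edges (cell C i< d<) t′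
  ... | (h₀ , v₀) , (v₁ , h₁) | (h₂ , v₂) , (v₃ , h₃) = record
    { i< = i< ; d< = d< ; h₀ = h₀ ; v₀ = v₀ ; v₁ = v₁ ; h₁ = h₁ ; h₂ = h₂ ; v₂ = v₂ ; v₃ = v₃ ; h₃ = h₃ }

  -- The blank cell leaves its west and north neighbours without an east and a south edge
  -- respectively. Not being blank, they must then have a north and a west edge, and these are the
  -- south and east edges of cell `(i , d)`.
  isolated⇒elbow : ∀ {i d} → suc i < n → suc d < n → isBlank (tl C (suc i) (suc d)) ≡ true →
    isBlank (tl C (suc i) d) ≡ false → isBlank (tl C i (suc d)) ≡ false → tl C i d ≡ br
  isolated⇒elbow i< d< b₃ b₂ b₁ with blank-edges (cell C i< d<) b₃
  ... | (h , v) , _ = out-both (cell C (<⇒≤ i<) (<⇒≤ d<))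
    (nonblank-E (cell C i< (<⇒≤ d<)) b₂ h) (nonblank-S (cell C (<⇒≤ i<) d<) b₁ v)

module Move {n m : ℕ} {s : ℕ → Bool} (C : Config n m s) {i d : ℕ} (M : Movable C i d) where
  open Movable M

  -- The four edges interior to a 2 by 2 square. Complementing them carries the blank from the lower
  -- right to the upper left cell and leaves the outer edges of the square alone.
  flipV flipH : ℕ → ℕ → Bool
  flipV a b = (a ≡ᵇ suc i) ∧ ((b ≡ᵇ d) ∨ (b ≡ᵇ suc d))
  flipH a b = (b ≡ᵇ suc d) ∧ ((a ≡ᵇ i) ∨ (a ≡ᵇ suc i))

  V′ H′ : ℕ → ℕ → Bool
  V′ a b = if flipV a b then not (V C a b) else V C a b
  H′ a b = if flipH a b then not (H C a b) else H C a b

  cell′ : ∀ {a b} → a < n → b < n → Cell (H′ a b) (V′ a b) (V′ (suc a) b) (H′ a (suc b))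
  cell′ {a} {b} a<n b<n with cell C a<n b<n | view i a | view d b
  ... | c | other e e′ | other f f′ rewrite e | e′ | f | f′ = c
  ... | c | other e e′ | same rewrite e | e′ | ≡ᵇ-suc d | ≡ᵇ-refl d = c
  ... | c | other e e′ | next rewrite e | e′ | suc-≡ᵇ d | ≡ᵇ-refl d = c
  ... | c | same       | other f f′ rewrite f | f′ | ≡ᵇ-suc i | ≡ᵇ-refl i = c
  ... | c | next       | other f f′ rewrite f | f′ | suc-≡ᵇ i | ≡ᵇ-refl i = c
  ... | c | same       | same
    rewrite ≡ᵇ-suc i | ≡ᵇ-refl i | ≡ᵇ-suc d | ≡ᵇ-refl d | h₀ | v₀ | v₁ | h₁ = blank
  ... | c | next       | next
    rewrite suc-≡ᵇ i | ≡ᵇ-refl i | suc-≡ᵇ d | ≡ᵇ-refl d | h₂ | v₂ | v₃ | h₃ = jay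
  ... | c | next       | same
    rewrite suc-≡ᵇ i | ≡ᵇ-refl i | ≡ᵇ-suc d | ≡ᵇ-refl d | v₁ | h₂ = below c
    where
    below : ∀ {W S} → Cell W true S false → Cell W false S true
    below down = elbow
    below jay  = flat
  ... | c | same       | next
    rewrite ≡ᵇ-suc i | ≡ᵇ-refl i | suc-≡ᵇ d | ≡ᵇ-refl d | h₁ | v₂ = beside c
    where
    beside : ∀ {N E} → Cell true N false E → Cell false N true E
    beside flat = elbow
    beside jay  = down

  moved : Config n m s
  moved = record
    { V = V′ ; H = H′
    -- Flipped edges lie strictly inside the grid, by `suc i < n` and `suc d < n`, so all four
    -- borders survive.
    ; top = top C
    ; left = left C
    ; bottom = λ d<n → trans (unflipped-n _) (bottom C d<n)
    ; right = λ i<n → trans (unflippedH-n _) (right C i<n)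
    ; cell = cell′ }
    where
    unflipped-n : ∀ b → V′ n b ≡ V C n b
    unflipped-n b rewrite ≢⇒≡ᵇ (λ e → <-irrefl (sym e) i<) = refl
    unflippedH-n : ∀ a → H′ a n ≡ H C a n
    unflippedH-n a rewrite ≢⇒≡ᵇ (λ e → <-irrefl (sym e) d<) = refl

  moved-row : ∀ {a} b → (a ≡ᵇ i) ≡ false → (a ≡ᵇ suc i) ≡ false → tl moved a b ≡ tl C a b
  moved-row b e e′ with view d b
  ... | same        rewrite e | e′ | ≡ᵇ-suc d = refl
  ... | next        rewrite e | e′ | ≡ᵇ-refl d = refl
  ... | other f f′  rewrite e | e′ | f′ = refl

  moved-col : ∀ a {b} → (b ≡ᵇ d) ≡ false → (b ≡ᵇ suc d) ≡ false → tl moved a b ≡ tl C a b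
  moved-col a f f′ with view i a
  ... | same        rewrite f | f′ | ≡ᵇ-suc i | ≡ᵇ-refl i = refl
  ... | next        rewrite f | f′ | suc-≡ᵇ i | ≡ᵇ-refl i = refl
  ... | other e e′  rewrite f | f′ | e | e′ = refl

  moved-blank : tl moved i d ≡ bblank
  moved-blank rewrite ≡ᵇ-suc i | ≡ᵇ-refl i | ≡ᵇ-suc d | ≡ᵇ-refl d | h₀ | v₀ | v₁ = refl

  moved-jay : tl moved (suc i) (suc d) ≡ bj
  moved-jay rewrite suc-≡ᵇ i | ≡ᵇ-refl i | suc-≡ᵇ d | ≡ᵇ-refl d | h₂ | v₂ | v₃ = refl

  old-elbow : tl C i d ≡ br
  old-elbow rewrite h₀ | v₀ | v₁ = refl

  old-blank : tl C (suc i) (suc d) ≡ bblank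
  old-blank rewrite h₂ | v₂ | v₃ = refl

  moved-below : droopBelow (tl C (suc i) d) ≡ just (tl moved (suc i) d)
  moved-below with cell C i< (<⇒≤ d<)
  ... | c rewrite suc-≡ᵇ i | ≡ᵇ-refl i | ≡ᵇ-suc d | ≡ᵇ-refl d | v₁ | h₂ = below c
    where
    below : ∀ {W S} → Cell W true S false → droopBelow (tileOf W true S) ≡ just (tileOf W false S)
    below down = refl
    below jay  = refl

  moved-beside : droopRight (tl C i (suc d)) ≡ just (tl moved i (suc d))
  moved-beside with cell C (<⇒≤ i<) d<
  ... | c rewrite ≡ᵇ-suc i | ≡ᵇ-refl i | suc-≡ᵇ d | ≡ᵇ-refl d | h₁ | v₂ = beside c
    where
    beside : ∀ {N E} → Cell true N false E → droopRight (tileOf true N false) ≡ just (tileOf false N true)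
    beside flat = refl
    beside jay  = refl

-- Moves as updates of a grid.

crossIf : Bool → PTile
crossIf true  = pcross
crossIf false = pelbow

crossIf⁻ : ∀ {b} → crossIf b ≡ pcross → b ≡ true
crossIf⁻ {true} _ = refl

crossIf-elbow⁻ : ∀ {b} → crossIf b ≡ pelbow → b ≡ false
crossIf-elbow⁻ {false} _ = refl

isPCross-crossIf : ∀ b → isPCross (crossIf b) ≡ b
isPCross-crossIf true  = refl
isPCross-crossIf false = refl

update-other : ∀ {A : Set} (φ : ℕ → ℕ → A) i {j} x a {b} → (b ≡ᵇ j) ≡ false → update φ i j x a b ≡ φ a b
update-other φ i x a f rewrite f | ∧-zeroʳ (a ≡ᵇ i) = refl

module _ {A : Set} (φ ψ : ℕ → ℕ → A) (i j : ℕ)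
  (row : ∀ {a} b → (a ≡ᵇ i) ≡ false → (a ≡ᵇ suc i) ≡ false → ψ a b ≡ φ a b) where

  update-square : ∀ {w x y z} → ψ i j ≡ w → ψ (suc i) (suc j) ≡ z → ψ (suc i) j ≡ x → ψ i (suc j) ≡ y →
    (∀ a {b} → (b ≡ᵇ j) ≡ false → (b ≡ᵇ suc j) ≡ false → ψ a b ≡ φ a b) →
    ∀ a b → update (update (update (update φ i j w) (suc i) (suc j) z) (suc i) j x) i (suc j) y a b ≡ ψ a b
  update-square {w} {x} {y} {z} ew ez ex ey col a b with view i a | view j b
  ... | same | same rewrite ≡ᵇ-suc i | ≡ᵇ-refl i | ≡ᵇ-suc j | ≡ᵇ-refl j = sym ew
  ... | same | next rewrite ≡ᵇ-suc i | ≡ᵇ-refl i | suc-≡ᵇ j | ≡ᵇ-refl j = sym ey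
  ... | next | same rewrite suc-≡ᵇ i | ≡ᵇ-refl i | ≡ᵇ-suc j | ≡ᵇ-refl j = sym ex
  ... | next | next rewrite suc-≡ᵇ i | ≡ᵇ-refl i | suc-≡ᵇ j | ≡ᵇ-refl j = sym ez
  ... | other e e′ | _ = trans (sym (lemma e e′)) (sym (row b e e′))
    where
    lemma : (a ≡ᵇ i) ≡ false → (a ≡ᵇ suc i) ≡ false →
      φ a b ≡ update (update (update (update φ i j w) (suc i) (suc j) z) (suc i) j x) i (suc j) y a b
    lemma e e′ rewrite e | e′ = refl
  ... | _ | other f f′ = trans (update-other φ₃ i {suc j} y a {b} f′) (trans (update-other φ₂ (suc i) {j} x a {b} f)
    (trans (update-other φ₁ (suc i) {suc j} z a {b} f′) (trans (update-other φ i {j} w a {b} f) (sym (col a f f′)))))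
    where
    φ₁ = update φ i j w
    φ₂ = update φ₁ (suc i) (suc j) z
    φ₃ = update φ₂ (suc i) j x

  -- A pipe dream sees only which cells are blank, so two of the four cells changed by a move remain
  -- elbows. The bound `b < n` is there because the reflection `n ∸ suc b` of columns is injective
  -- only below `n`.
  update-antidiagonal : ∀ {x y} n → ψ (suc i) j ≡ x → ψ i (suc j) ≡ y → ψ i j ≡ φ i j →
    ψ (suc i) (suc j) ≡ φ (suc i) (suc j) →
    (∀ a {b} → b < n → (b ≡ᵇ j) ≡ false → (b ≡ᵇ suc j) ≡ false → ψ a b ≡ φ a b) →
    ∀ a b → b < n → update (update φ (suc i) j x) i (suc j) y a b ≡ ψ a b
  update-antidiagonal {x} {y} n ex ey ew ez col a b b<n with view i a | view j b
  ... | same | same rewrite ≡ᵇ-suc i | ≡ᵇ-refl i | ≡ᵇ-suc j = sym ew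
  ... | same | next rewrite ≡ᵇ-refl i | ≡ᵇ-refl j = sym ey
  ... | next | same rewrite suc-≡ᵇ i | ≡ᵇ-refl i | ≡ᵇ-refl j = sym ex
  ... | next | next rewrite suc-≡ᵇ i | ≡ᵇ-refl i | suc-≡ᵇ j = sym ez
  ... | other e e′ | _ = trans (sym (lemma e e′)) (sym (row b e e′))
    where
    lemma : (a ≡ᵇ i) ≡ false → (a ≡ᵇ suc i) ≡ false → φ a b ≡ update (update φ (suc i) j x) i (suc j) y a b
    lemma e e′ rewrite e | e′ = refl
  ... | _ | other f f′ = trans (update-other (update φ (suc i) j x) i {suc j} y a {b} f′)
    (trans (update-other φ (suc i) {j} x a {b} f) (sym (col a b<n f f′)))

-- Labels along used edges, and the cells of the Rothe columns.

catMaybes-just : ∀ (f : ℕ → ℕ) n → catMaybes (applyUpTo (just ∘ f) n) ≡ applyUpTo f n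
catMaybes-just f zero    = refl
catMaybes-just f (suc n) = cong (f 0 ∷_) (catMaybes-just (f ∘ suc) n)

catMaybes-nothing : ∀ (f : ℕ → Label) n → (∀ i → i < n → f i ≡ nothing) → catMaybes (applyUpTo f n) ≡ []
catMaybes-nothing f n h = trans (cong catMaybes (applyUpTo-cong n h)) (none n)
  where
  none : ∀ n → catMaybes (applyUpTo (λ _ → nothing {A = ℕ}) n) ≡ []
  none zero    = refl
  none (suc n) = none n

catMaybes-nothing↓ : ∀ (f : ℕ → Label) n → (∀ i → i < n → f i ≡ nothing) → catMaybes (applyDownFrom f n) ≡ []
catMaybes-nothing↓ f zero    h = refl
catMaybes-nothing↓ f (suc n) h rewrite h n (n<1+n n) = catMaybes-nothing↓ f n λ i i<n → h i (m<n⇒m<1+n i<n)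

is-just⇒ : ∀ {x : Label} → is-just x ≡ true → x ≡ just (fromMaybe 0 x)
is-just⇒ {just _} _ = refl

is-just-false⇒ : ∀ {x : Label} → is-just x ≡ false → x ≡ nothing
is-just-false⇒ {nothing} _ = refl

-- Without a crossing a cell carries at most one pipe, so an attribute that is false of absent
-- labels follows the used edges. The attribute is `is-just` in one use and `labelSmall` in the
-- other.
outgoing : ∀ {W N S E} {f : Label → Bool} → f nothing ≡ false → Cell W N S E → ∀ {s w} → f s ≡ S → f w ≡ W →
  f (outN (tileOf W N S) s w) ≡ N × f (outE (tileOf W N S) s w) ≡ E
outgoing f0 blank a b = f0 , f0
outgoing f0 elbow a b = f0 , a
outgoing f0 down  a b = a , b
outgoing f0 flat  a b = f0 , b
outgoing f0 jay   a b = b , f0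

-- Serves the rows from the bottom up, with `a = 0`, and the Rothe columns from right to left, with
-- `a = k`.
descend : ∀ {P : ℕ → Set} {a} n → P n → (∀ i → a ≤ i → i < n → P (suc i) → P i) → ∀ i → a ≤ i → i ≤ n → P i
descend {P} {a} n base step i a≤i i≤n = go (n ∸ i) i a≤i (m∸n+n≡m i≤n)
  where
  go : ∀ u i → a ≤ i → u + i ≡ n → P i
  go zero    i a≤i refl = base
  go (suc u) i a≤i e = step i a≤i (subst (suc i ≤_) e (s≤s (m≤n+m i u)))
    (go u (suc i) (m≤n⇒m≤1+n a≤i) (trans (+-suc u i) e))

-- The four edges, in the order used for Cell, of a Rothe tile in a column ≥ k.
data RotheCell : Bool → Bool → Bool → Bool → Set where
  crossing : RotheCell true  true  true  true
  corner   : RotheCell false false true  true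
  vertical : RotheCell false true  true  false
  across   : RotheCell true  false false true

labelIf : Bool → ℕ → Label
labelIf b a = if b then just a else nothing

is-just-labelIf : ∀ b a → is-just (labelIf b a) ≡ b
is-just-labelIf true  a = refl
is-just-labelIf false a = refl

-- Columns ≥ k are recovered from right to left, each from its lowest tile upwards: the label from the south and
-- the label to the east determine the tile, since a large pipe never enters a crossing from the west.
rothe-forced : ∀ t {s w W N S E j x} → RotheCell W N S E → Agrees t s w →
  s ≡ labelIf S j → outE t s w ≡ labelIf E x →
  (W ≡ true → x ≢ j) → (W ≡ false → x ≡ j ⊎ E ≡ false) → (t ≡ bcross → w ≢ just j) →
  w ≡ labelIf W x × outN t s w ≡ labelIf N j
rothe-forced bcross crossing ag refl refl _ _ _ = refl , refl
rothe-forced br     crossing ag refl refl x≢j _ _ = ⊥-elim (x≢j refl refl)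
rothe-forced bver   crossing (_ , a) refl refl _ _ _ with () ← a
rothe-forced bhor   crossing (() , _) refl e _ _ _
rothe-forced bj     crossing (() , _) refl e _ _ _
rothe-forced bblank crossing (() , _) refl e _ _ _
rothe-forced bcross corner ag refl refl _ x≡j w≢j with x≡j refl
... | inj₁ refl = ⊥-elim (w≢j refl refl)
rothe-forced br     corner (_ , a) refl e _ _ _ = is-just-false⇒ a , refl
rothe-forced bver   corner (_ , a) refl refl _ _ _ with () ← a
rothe-forced bhor   corner (() , _) refl e _ _ _
rothe-forced bj     corner (() , _) refl e _ _ _
rothe-forced bblank corner (() , _) refl e _ _ _
rothe-forced bcross vertical (_ , a) refl refl _ _ _ with () ← a
rothe-forced bver   vertical (_ , a) refl e _ _ _ = is-just-false⇒ a , refl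
rothe-forced br     vertical ag refl () _ _ _
rothe-forced bhor   vertical (() , _) refl e _ _ _
rothe-forced bj     vertical (() , _) refl e _ _ _
rothe-forced bblank vertical (() , _) refl e _ _ _
rothe-forced bhor   across ag refl refl _ _ _ = refl , refl
rothe-forced bcross across (() , _) refl e _ _ _
rothe-forced bver   across (() , _) refl e _ _ _
rothe-forced br     across (() , _) refl e _ _ _
rothe-forced bj     across ag refl () _ _ _
rothe-forced bblank across ag refl () _ _ _

-- Here `x` is the size of the pipe that finally leaves the row. Vertical labels in these columns
-- are large, so a corner, where one of them turns into the row, is compatible only with a large
-- exit.
rothe-class : ∀ {W N S E} {f : Label → Bool} {x} → f nothing ≡ false → RotheCell W N S E → ∀ {s w} →
  f s ≡ false → f w ≡ x → (W ≡ false → E ≡ true → x ≡ false) →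
  f (outN (tileOf W N S) s w) ≡ false × f (outE (tileOf W N S) s w) ≡ x
rothe-class f0 crossing a b h = a , b
rothe-class f0 corner   a b h = f0 , trans a (sym (h refl refl))
rothe-class f0 vertical a b h = a , b
rothe-class f0 across   a b h = f0 , b

rothe-agrees : ∀ {W N S E s w} → RotheCell W N S E → is-just s ≡ S → is-just w ≡ W →
  is-just (outN (tileOf W N S) s w) ≡ N × is-just (outE (tileOf W N S) s w) ≡ E
rothe-agrees crossing a b = a , b
rothe-agrees corner   a b = refl , a
rothe-agrees vertical a b = a , b
rothe-agrees across   a b = refl , b

edges-rothe : ∀ {W N S E} → RotheCell W N S E →
  (edgeW (tileOf W N S) ≡ W × edgeN (tileOf W N S) ≡ N) × (edgeS (tileOf W N S) ≡ S × edgeE (tileOf W N S) ≡ E)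
edges-rothe crossing = (refl , refl) , (refl , refl)
edges-rothe corner   = (refl , refl) , (refl , refl)
edges-rothe vertical = (refl , refl) , (refl , refl)
edges-rothe across   = (refl , refl) , (refl , refl)

tileOf-edges : ∀ t → tileOf (edgeW t) (edgeN t) (edgeS t) ≡ t
tileOf-edges bcross = refl
tileOf-edges bhor   = refl
tileOf-edges bver   = refl
tileOf-edges br     = refl
tileOf-edges bj     = refl
tileOf-edges bblank = refl

uncrossed-cell : ∀ t → t ≢ bcross → Cell (edgeW t) (edgeN t) (edgeS t) (edgeE t)
uncrossed-cell bcross h = ⊥-elim (h refl)
uncrossed-cell bhor   h = flat
uncrossed-cell bver   h = down
uncrossed-cell br     h = elbow
uncrossed-cell bj     h = jay
uncrossed-cell bblank h = blank

uncrossed-out : ∀ {f : Label → Bool} t {s w} → f nothing ≡ false → f s ≡ is-just s → f w ≡ is-just w →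
  f (outN t s w) ≡ is-just (outN t s w) × f (outE t s w) ≡ is-just (outE t s w)
uncrossed-out bcross f0 a b = a , b
uncrossed-out bhor   f0 a b = f0 , b
uncrossed-out bver   f0 a b = a , b
uncrossed-out br     f0 a b = f0 , a
uncrossed-out bj     f0 a b = b , f0
uncrossed-out bblank f0 a b = f0 , f0

proj₁-injective : ∀ {A : Set} {B : A → Set} → (∀ x (u v : B x) → u ≡ v) → {y z : Σ A B} → proj₁ y ≡ proj₁ z → y ≡ z
proj₁-injective irr {x , u} {_ , v} refl = cong (x ,_) (irr x u v)

conditions-irrelevant : ∀ {a b} {X : Set} {x y : X} (u v : T a × T b × x ≡ y) → u ≡ v
conditions-irrelevant (s , r , e) (s′ , r′ , e′) = cong₂ _,_ (T-irrelevant s s′) (cong₂ _,_ (T-irrelevant r r′) (uip e e′))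

-- Inverse-Grassmannian permutations

-- p and q are π and its inverse on indices; k is the number of small labels.
module Correspondence (n m k : ℕ) (m+k≡n : m + k ≡ n) (p q : ℕ → ℕ)
  (p< : ∀ {i} → i < n → p i < n) (q< : ∀ {v} → v < n → q v < n)
  (qp : ∀ {i} → i < n → q (p i) ≡ i) (pq : ∀ {v} → v < n → p (q v) ≡ v)
  (q-small : ∀ {a b} → a < b → b < k → q a < q b)
  (q-large : ∀ {a b} → k ≤ a → a < b → b < n → q a < q b) where

  open Classes k

  -- A row is used at the right border iff its exit is small. For a pipe dream this is the size of
  -- the label leaving to the west; for a bumpless pipe dream it says which rows lead from the
  -- columns below `k` into the Rothe columns.
  Cfg : Set
  Cfg = Config n m (λ i → small (p i))

  m≤n : m ≤ n
  m≤n = subst (m ≤_) m+k≡n (m≤m+n m k)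

  k≤n : k ≤ n
  k≤n = subst (k ≤_) m+k≡n (m≤n+m k m)

  shift< : ∀ {j} → j < k → m + j < n
  shift< {j} j<k = subst (m + j <_) m+k≡n (+-monoʳ-< m j<k)

  unshift< : ∀ {j} → m + j < n → j < k
  unshift< {j} h = +-cancelˡ-< m j k (subst (m + j <_) (sym m+k≡n) h)

  -- The columns k , k + 1 , … of a bumpless pipe dream agree with those of the Rothe diagram.
  rothe : ℕ → ℕ → BTile
  rothe i j = tileOf (p i <ᵇ j) (q j <ᵇ i) (q j <ᵇ suc i)

  large-order : ∀ {i j} → i < n → k ≤ j → j < n → j ≤ p i → q j ≤ i
  large-order {i} {j} i<n k≤j j<n j≤pi with m≤n⇒m<n∨m≡n j≤pi
  ... | inj₁ j<pi = subst (q j ≤_) (qp i<n) (<⇒≤ (q-large k≤j j<pi (p< i<n)))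
  ... | inj₂ refl = ≤-reflexive (qp i<n)

  -- A blank of the Rothe diagram at `(i , j)` is an inversion, `j < p i` with `i < q j`. If `j` is
  -- large then so is `p i`, and `q` increases on large labels.
  rothe-nonblank : ∀ {i j} → i < n → k ≤ j → j < n → isBlank (rothe i j) ≡ false
  rothe-nonblank {i} {j} i<n k≤j j<n with p i <ᵇ j in e
  ... | false rewrite <ᵇ-true (s≤s (large-order i<n k≤j j<n (<ᵇ-false⁻ e))) with q j <ᵇ i
  ...   | true  = refl
  ...   | false = refl
  rothe-nonblank {i} {j} i<n k≤j j<n | true with q j <ᵇ i in e′
  ... | true rewrite <ᵇ-true {q j} {suc i} (m<n⇒m<1+n (<ᵇ-true⁻ e′)) = refl
  ... | false = refl

  bTile : Cfg → ℕ → ℕ → BTile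
  bTile C i j = if j <ᵇ k then tl C i (m + j) else rothe i j

  bpd : Cfg → BGrid n
  bpd C = grid (bTile C) n

  pTile : Cfg → ℕ → ℕ → PTile
  pTile C i c = crossIf (isBlank (tl C i (n ∸ suc c)))

  pd : Cfg → PGrid n
  pd C = grid (pTile C) n

  bTile-left : ∀ C {i j} → j < k → bTile C i j ≡ tl C i (m + j)
  bTile-left C j<k rewrite <ᵇ-true j<k = refl

  bTile-right : ∀ C {i j} → k ≤ j → bTile C i j ≡ rothe i j
  bTile-right C k≤j rewrite <ᵇ-false k≤j = refl

  blank-left : ∀ C {i j} → i < n → j < n → isBlank (bTile C i j) ≡ true → j < k
  blank-left C {i} {j} i<n j<n e with j <? k
  ... | yes j<k = j<k
  ... | no  j≮k with () ← trans (sym e) (trans (cong isBlank (bTile-right C (≮⇒≥ j≮k))) (rothe-nonblank i<n (≮⇒≥ j≮k) j<n))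

  padding-nonblank : ∀ (C : Cfg) {i d} → i < n → d < m → isBlank (tl C i d) ≡ false
  padding-nonblank C {i} {d} i<n d<m
    rewrite proj₁ (padding C m≤n (<⇒≤ i<n)) d<m | proj₂ (padding C m≤n (<⇒≤ i<n)) i<n d (<⇒≤ d<m) = refl

  complement< : ∀ {d} → d < n → n ∸ suc d < n
  complement< {d} d<n = subst (_≤ n) (sym (suc∸suc d<n)) (m∸n≤m n d)

  complement-involutive : ∀ {d} → d < n → n ∸ suc (n ∸ suc d) ≡ d
  complement-involutive {d} d<n = trans (cong (n ∸_) (suc∸suc d<n)) (m∸[m∸n]≡n (<⇒≤ d<n))

  column : ∀ d → d < m ⊎ ∃ λ j → d ≡ m + j
  column d with d <? m
  ... | yes d<m = inj₁ d<m
  ... | no  d≮m = inj₂ (d ∸ m , sym (m+[n∸m]≡n (≮⇒≥ d≮m)))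

  -- Each of the two grids determines the tiles of its configuration.

  bpd-blanks : ∀ C D → bpd C ≡ bpd D → ∀ {i d} → i < n → d < n → isBlank (tl C i d) ≡ isBlank (tl D i d)
  bpd-blanks C D e {i} {d} i<n d<n with column d
  ... | inj₁ d<m = trans (padding-nonblank C i<n d<m) (sym (padding-nonblank D i<n d<m))
  ... | inj₂ (j , refl) = cong isBlank (trans (sym (bTile-left C (unshift< d<n)))
    (trans (grid-injective e i<n (≤-trans (unshift< d<n) k≤n)) (bTile-left D (unshift< d<n))))

  pd-blanks : ∀ C D → pd C ≡ pd D → ∀ {i d} → i < n → d < n → isBlank (tl C i d) ≡ isBlank (tl D i d)
  pd-blanks C D e {i} {d} i<n d<n = trans (sym (isPCross-crossIf _)) (trans (cong isPCross eq) (isPCross-crossIf _))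
    where
    eq : crossIf (isBlank (tl C i d)) ≡ crossIf (isBlank (tl D i d))
    eq = subst (λ x → crossIf (isBlank (tl C i x)) ≡ crossIf (isBlank (tl D i x))) (complement-involutive d<n)
      (grid-injective {φ = pTile C} {pTile D} e i<n (complement< d<n))

  Same : Cfg → Cfg → Set
  Same C D = ∀ {i d} → i < n → d < n → tl C i d ≡ tl D i d

  same-bpd : ∀ C D → Same C D → bpd C ≡ bpd D
  same-bpd C D e = grid-cong n λ i j i<n j<n → eq i j i<n
    where
    eq : ∀ i j → i < n → bTile C i j ≡ bTile D i j
    eq i j i<n with j <ᵇ k in j<k
    ... | true  = e i<n (shift< (<ᵇ-true⁻ j<k))
    ... | false = refl

  same-pd : ∀ C D → Same C D → pd C ≡ pd D
  same-pd C D e = grid-cong n λ i c i<n c<n → cong (λ t → crossIf (isBlank t)) (e i<n (complement< c<n))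

  -- A configuration has values outside the grid and carries proofs, so configurations are compared
  -- through their diagrams: equal grids have the same blank cells, and these fix all edges within
  -- the grid.
  bpd≡⇒pd≡ : ∀ C D → bpd C ≡ bpd D → pd C ≡ pd D
  bpd≡⇒pd≡ C D e = same-pd C D (same-tiles C D (blanks-determine C D (bpd-blanks C D e)))

  pd≡⇒bpd≡ : ∀ C D → pd C ≡ pd D → bpd C ≡ bpd D
  pd≡⇒bpd≡ C D e = same-bpd C D (same-tiles C D (blanks-determine C D (pd-blanks C D e)))

  -- Droops and slides as moves of configurations.

  module _ (C : Cfg) where

    droop-grid : ∀ {i j} (M : Movable C i (m + j)) → suc j < k → let C′ = Move.moved C M in
      bpd C′ ≡ set (set (set (set (bpd C) i j bblank) (suc i) (suc j) bj)
                     (suc i) j (tl C′ (suc i) (m + j))) i (suc j) (tl C′ i (suc (m + j)))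
    droop-grid {i} {j} M j<k = sym (trans
        (cong (λ D → set (set (set D (suc i) (suc j) bj) (suc i) j x) i (suc j) y) (set-grid (bTile C) n i j bblank))
      (trans (cong (λ D → set (set D (suc i) j x) i (suc j) y) (set-grid φ₁ n (suc i) (suc j) bj))
      (trans (cong (λ D → set D i (suc j) y) (set-grid φ₂ n (suc i) j x))
      (trans (set-grid φ₃ n i (suc j) y) (grid-cong n λ a b _ _ → eq a b)))))
      where
      open Move C M
      x = tl moved (suc i) (m + j)
      y = tl moved i (suc (m + j))
      φ₁ = update (bTile C) i j bblank
      φ₂ = update φ₁ (suc i) (suc j) bj
      φ₃ = update φ₂ (suc i) j x
      left-tile : ∀ a {b} → b < k → bTile moved a b ≡ tl moved a (m + b)
      left-tile a = bTile-left moved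
      row : ∀ {a} b → (a ≡ᵇ i) ≡ false → (a ≡ᵇ suc i) ≡ false → bTile moved a b ≡ bTile C a b
      row {a} b e e′ = cong (λ t → if b <ᵇ k then t else rothe a b) (moved-row (m + b) e e′)
      col : ∀ a {b} → (b ≡ᵇ j) ≡ false → (b ≡ᵇ suc j) ≡ false → bTile moved a b ≡ bTile C a b
      col a {b} f f′ = cong (λ t → if b <ᵇ k then t else rothe a b) (moved-col a (trans (+-≡ᵇ m b j) f)
        (trans (cong (m + b ≡ᵇ_) (sym (+-suc m j))) (trans (+-≡ᵇ m b (suc j)) f′)))
      eq : ∀ a b → update φ₃ i (suc j) y a b ≡ bTile moved a b
      eq = update-square (bTile C) (bTile moved) i j row
        (trans (left-tile i (<⇒≤ j<k)) moved-blank)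
        (trans (left-tile (suc i) j<k) (trans (cong (tl moved (suc i)) (+-suc m j)) moved-jay))
        (left-tile (suc i) (<⇒≤ j<k))
        (trans (left-tile i j<k) (cong (tl moved i) (+-suc m j)))
        col

    droop-move : ∀ {i j} (M : Movable C i (m + j)) → suc j < k → SimpleDroop (bpd C) (bpd (Move.moved C M))
    droop-move {i} {j} M j<k = droop i j (tl C (suc i) (m + j)) (tl C i (suc (m + j)))
      (tl moved (suc i) (m + j)) (tl moved i (suc (m + j)))
      (trans (at-left i (<⇒≤ i<) (<⇒≤ j<k)) (cong just old-elbow))
      (trans (at-left (suc i) i< j<k) (cong just (trans (cong (tl C (suc i)) (+-suc m j)) old-blank)))
      (at-left (suc i) i< (<⇒≤ j<k))
      (trans (at-left i (<⇒≤ i<) j<k) (cong (just ∘ tl C i) (+-suc m j)))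
      moved-below moved-beside (droop-grid M j<k)
      where
      open Move C M
      open Movable M
      at-left : ∀ a {b} → a < n → b < k → at (bpd C) a b ≡ just (tl C a (m + b))
      at-left a a<n b<k = trans (at-grid (bTile C) a<n (≤-trans b<k k≤n)) (cong just (bTile-left C b<k))

    -- The reflected columns enter as equations, since `slide-move` is given `d` while `slide⇒` is
    -- given `c`.
    slide-grid : ∀ {i d c} (M : Movable C i d) → n ∸ suc c ≡ suc d → n ∸ suc (suc c) ≡ d → suc c < n →
      pd (Move.moved C M) ≡ set (set (pd C) (suc i) c pelbow) i (suc c) pcross
    slide-grid {i} {d} {c} M e₁ e₀ c<n = sym (trans (cong (λ D → set D i (suc c) pcross) (set-grid (pTile C) n (suc i) c pelbow))
      (trans (set-grid φ₁ n i (suc c) pcross) (grid-cong n λ a b _ b<n → eq a b b<n)))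
      where
      open Move C M
      φ₁ = update (pTile C) (suc i) c pelbow
      nonblank-below : ∀ {t t′} → droopBelow t ≡ just t′ → isBlank t′ ≡ isBlank t
      nonblank-below {bver} refl = refl
      nonblank-below {bj}   refl = refl
      nonblank-beside : ∀ {t t′} → droopRight t ≡ just t′ → isBlank t′ ≡ isBlank t
      nonblank-beside {bhor} refl = refl
      nonblank-beside {bj}   refl = refl
      distinct : ∀ {b b′ x} → b < n → b′ < n → n ∸ suc b′ ≡ x → (b ≡ᵇ b′) ≡ false → (n ∸ suc b ≡ᵇ x) ≡ false
      distinct {b} {b′} {x} b<n b′<n e f = ≢⇒≡ᵇ λ e′ → not-same (trans (sym (complement-involutive b<n))
        (trans (cong (λ y → n ∸ suc y) (trans e′ (sym e))) (complement-involutive b′<n)))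
        where
        not-same : b ≢ b′
        not-same refl with () ← trans (sym f) (≡ᵇ-refl b)
      at-column : ∀ a {b x} → n ∸ suc b ≡ x → pTile moved a b ≡ crossIf (isBlank (tl moved a x))
      at-column a refl = refl
      at-column₀ : ∀ a {b x} → n ∸ suc b ≡ x → crossIf (isBlank (tl C a x)) ≡ pTile C a b
      at-column₀ a refl = refl
      eq : ∀ a b → b < n → update φ₁ i (suc c) pcross a b ≡ pTile moved a b
      eq = update-antidiagonal (pTile C) (pTile moved) i c
        (λ b e e′ → cong (crossIf ∘ isBlank) (moved-row (n ∸ suc b) e e′)) n
        (trans (at-column (suc i) e₁) (cong (crossIf ∘ isBlank) moved-jay))
        (trans (at-column i e₀) (cong (crossIf ∘ isBlank) moved-blank))
        (trans (at-column i e₁) (trans (cong crossIf (nonblank-beside moved-beside)) (at-column₀ i e₁)))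
        (trans (at-column (suc i) e₀) (trans (cong crossIf (nonblank-below moved-below)) (at-column₀ (suc i) e₀)))
        (λ a b<n f f′ → cong (crossIf ∘ isBlank) (moved-col a (distinct b<n c<n e₀ f′) (distinct b<n (<⇒≤ c<n) e₁ f)))

    slide-move : ∀ {i d} (M : Movable C i d) → SimpleSlide (pd C) (pd (Move.moved C M))
    slide-move {i} {d} M = slide i c
      (trans (at-cross (suc i) i< (<⇒≤ c<n) e₁) (cong (just ∘ crossIf ∘ isBlank) old-blank))
      (trans (at-cross (suc i) i< c<n e₀) (cong (just ∘ crossIf) (below-nonblank moved-below)))
      (trans (at-cross i (<⇒≤ i<) (<⇒≤ c<n) e₁) (cong (just ∘ crossIf) (beside-nonblank moved-beside)))
      (trans (at-cross i (<⇒≤ i<) c<n e₀) (cong (just ∘ crossIf ∘ isBlank) old-elbow))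
      (slide-grid M e₁ e₀ c<n)
      where
      open Move C M
      open Movable M
      c = n ∸ suc (suc d)
      e₁ : n ∸ suc c ≡ suc d
      e₁ = complement-involutive d<
      c<n : suc c < n
      c<n = subst (_< n) (sym (suc∸suc d<)) (complement< (<⇒≤ d<))
      e₀ : n ∸ suc (suc c) ≡ d
      e₀ = trans (cong (λ x → n ∸ suc x) (suc∸suc d<)) (complement-involutive (<⇒≤ d<))
      at-cross : ∀ a {b x} → a < n → b < n → n ∸ suc b ≡ x → at (pd C) a b ≡ just (crossIf (isBlank (tl C a x)))
      at-cross a a<n b<n refl = at-grid (pTile C) a<n b<n
      below-nonblank : ∀ {t t′} → droopBelow t ≡ just t′ → isBlank t ≡ false
      below-nonblank {bver} refl = refl
      below-nonblank {bj}   refl = refl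
      beside-nonblank : ∀ {t t′} → droopRight t ≡ just t′ → isBlank t ≡ false
      beside-nonblank {bhor} refl = refl
      beside-nonblank {bj}   refl = refl

    -- A blank tile lies in a column below `k`. The other three tiles of the square then do so as
    -- well, and the droop is a move of the configuration.
    droop⇒ : ∀ {Y} → SimpleDroop (bpd C) Y → ∃ λ C′ → Y ≡ bpd C′ × SimpleSlide (pd C) (pd C′)
    droop⇒ (droop i j tb tr tb′ tr′ a₀ a₃ a₂ a₁ below beside eq)
      with at-grid⁻ (bTile C) {n} a₀ | at-grid⁻ (bTile C) {n} a₃ | at-grid⁻ (bTile C) {n} a₂ | at-grid⁻ (bTile C) {n} a₁
    ... | _ , _ , t₀ | i< , j< , t₃ | _ , _ , t₂ | _ , _ , t₁ = moved , trans eq (sym eq′) , slide-move M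
      where
      j<k : suc j < k
      j<k = blank-left C i< j< (cong isBlank t₃)
      M : Movable C i (m + j)
      M = movable C i< (subst (_< n) (+-suc m j) (shift< j<k)) (trans (sym (bTile-left C (<⇒≤ j<k))) t₀)
        (trans (cong (isBlank ∘ tl C (suc i)) (sym (+-suc m j))) (cong isBlank (trans (sym (bTile-left C j<k)) t₃)))
      open Move C M
      x≡ : tl moved (suc i) (m + j) ≡ tb′
      x≡ = just-injective (trans (sym moved-below)
        (trans (cong droopBelow (trans (sym (bTile-left C (<⇒≤ j<k))) t₂)) below))
      y≡ : tl moved i (suc (m + j)) ≡ tr′
      y≡ = just-injective (trans (sym moved-beside)
        (trans (cong droopRight (trans (cong (tl C i) (sym (+-suc m j))) (trans (sym (bTile-left C j<k)) t₁))) beside))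
      eq′ : bpd moved ≡ set (set (set (set (bpd C) i j bblank) (suc i) (suc j) bj) (suc i) j tb′) i (suc j) tr′
      eq′ = subst₂ (λ x y → bpd moved ≡ set (set (set (set (bpd C) i j bblank) (suc i) (suc j) bj) (suc i) j x) i (suc j) y)
        x≡ y≡ (droop-grid M j<k)

    -- A cross whose two neighbours in the square are elbows forces the cell opposite to it to be
    -- the elbow that a move requires.
    slide⇒ : ∀ {Y} → SimpleSlide (pd C) Y → ∃ λ C′ → Y ≡ pd C′ × SimpleDroop (bpd C) (bpd C′)
    slide⇒ (slide i c a₃ a₂ a₁ a₀ eq)
      with at-grid⁻ (pTile C) {n} a₃ | at-grid⁻ (pTile C) {n} a₂ | at-grid⁻ (pTile C) {n} a₁
    ... | i< , _ , t₃ | _ , c< , t₂ | _ , _ , t₁ = moved , trans eq (sym (slide-grid M (sym e₁) refl c<)) , in-left (column d)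
      where
      d = n ∸ suc (suc c)
      e₁ : suc d ≡ n ∸ suc c
      e₁ = suc∸suc c<
      d< : suc d < n
      d< = subst (_< n) (sym e₁) (complement< (<⇒≤ c<))
      b₃ : isBlank (tl C (suc i) (suc d)) ≡ true
      b₃ = trans (cong (isBlank ∘ tl C (suc i)) e₁) (crossIf⁻ t₃)
      M : Movable C i d
      M = movable C i< d< (isolated⇒elbow C i< d< b₃ (crossIf-elbow⁻ t₂)
        (trans (cong (isBlank ∘ tl C i) e₁) (crossIf-elbow⁻ t₁))) b₃
      open Move C M
      in-left : d < m ⊎ (∃ λ j → d ≡ m + j) → SimpleDroop (bpd C) (bpd moved)
      in-left (inj₁ d<m) with () ← trans (sym (Movable.v₀ M)) (proj₁ (padding C m≤n (<⇒≤ (<⇒≤ i<))) d<m)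
      in-left (inj₂ (j , e)) = go d e M
        where
        go : ∀ d → d ≡ m + j → (M : Movable C i d) → SimpleDroop (bpd C) (bpd (Move.moved C M))
        go _ refl M = droop-move M (unshift< (subst (_< n) (sym (+-suc m j)) (Movable.d< M)))

  -- The grids inside a chain come without proofs of validity; `droop⇒` supplies the configuration
  -- behind each of them in turn. At the end of the chain `bpd≡⇒pd≡` identifies the configuration
  -- reached with `D`.
  droops⇒slides : ∀ C D → Star SimpleDroop (bpd C) (bpd D) → Star SimpleSlide (pd C) (pd D)
  droops⇒slides C D s = go C refl s
    where
    go : ∀ C {X} → X ≡ bpd C → Star SimpleDroop X (bpd D) → Star SimpleSlide (pd C) (pd D)
    go C e ε = subst (Star SimpleSlide (pd C)) (bpd≡⇒pd≡ C D (sym e)) ε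
    go C refl (x ◅ s) with droop⇒ C x
    ... | C′ , e , y = y ◅ go C′ e s

  slides⇒droops : ∀ C D → Star SimpleSlide (pd C) (pd D) → Star SimpleDroop (bpd C) (bpd D)
  slides⇒droops C D s = go C refl s
    where
    go : ∀ C {X} → X ≡ pd C → Star SimpleSlide X (pd D) → Star SimpleDroop (bpd C) (bpd D)
    go C e ε = subst (Star SimpleDroop (bpd C)) (pd≡⇒bpd≡ C D (sym e)) ε
    go C refl (x ◅ s) with slide⇒ C x
    ... | C′ , e , y = y ◅ go C′ e s

  -- Besides the `k` columns that correspond, each side has `m` columns free of blanks: the Rothe
  -- columns on the right of one, the padding on the left of the other.
  row-weight : ∀ C {i} → i < n → tally (isBlank ∘ bTile C i) n ≡ tally (isBlank ∘ tl C i) n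
  row-weight C {i} i<n = trans (cong (tally _) (trans (sym m+k≡n) (+-comm m k)))
    (trans (tally-+ _ k m)
    (trans (cong₂ _+_
        (tally-cong k λ j j<k → cong isBlank (bTile-left C j<k))
        (tally-none m λ j j<m → trans (cong isBlank (bTile-right C (m≤m+n k j)))
          (rothe-nonblank i<n (m≤m+n k j) (subst (k + j <_) (trans (+-comm k m) m+k≡n) (+-monoʳ-< k j<m)))))
    (trans (+-comm _ 0)
    (trans (cong (_+ tally (λ j → isBlank (tl C i (m + j))) k)
        (sym (tally-none m λ d d<m → padding-nonblank C i<n d<m)))
    (trans (sym (tally-+ (isBlank ∘ tl C i) m k)) (cong (tally _) m+k≡n))))))

  weight : ∀ C → wtBPD (bpd C) ≡ wtPD (pd C)
  weight C = trans (cong (map (count isBlank)) (rows-grid (bTile C) n))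
    (trans (map-applyUpTo (λ i → applyUpTo (bTile C i) n) (count isBlank) n)
    (trans (applyUpTo-cong n (λ i i<n → trans (count-applyUpTo isBlank (bTile C i) n)
      (trans (row-weight C i<n) (sym (row i)))))
    (sym (trans (cong (map (count isPCross)) (rows-grid (pTile C) n))
      (map-applyUpTo (λ i → applyUpTo (pTile C i) n) (count isPCross) n)))))
    where
    row : ∀ i → count isPCross (applyUpTo (pTile C i) n) ≡ tally (isBlank ∘ tl C i) n
    row i = trans (cong (count isPCross) (applyUpTo-reversed (pTile C i) n))
      (trans (count-applyDownFrom isPCross _ n) (tally-cong n λ d d<n →
        trans (isPCross-crossIf _) (cong (isBlank ∘ tl C i) (complement-involutive d<n))))

  -- Reducedness in terms of the sizes of labels.

  word : List ℕ
  word = applyUpTo p n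

  labelSmall : Label → Bool
  labelSmall nothing  = false
  labelSmall (just a) = small a

  MixedLabels : Bool → Label × Label → Set
  MixedLabels true  (x , y) = labelSmall x ≡ true × labelSmall y ≡ false
  MixedLabels false (x , y) = labelSmall y ≡ true × labelSmall x ≡ false

  mixedLabels : ∀ o c → Mixed c → MixedLabels o (orient o c)
  mixedLabels true  c m = m
  mixedLabels false c m = m

  mixedLabels⁻ : ∀ o c → MixedLabels o (orient o c) → Mixed c
  mixedLabels⁻ true  c m = m
  mixedLabels⁻ false c m = m

  -- Since `q` increases on each class, two labels of one class appear in increasing order in the
  -- word of π. An inversion therefore has one label in each class.
  inversion-mixed : ∀ {a b} → Before a b (upTo n) → Before b a word → Mixed (a , b)
  inversion-mixed {a} {b} l r with before-applyUpTo id n l | before-applyUpTo p n r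
  ... | _ , _ , a<b , b<n , refl , refl | i , j , i<j , j<n , pi≡b , pj≡a = go (a <? k) (b <? k)
    where
    qb<qa : q b < q a
    qb<qa = subst₂ _<_ (trans (sym (qp (<-trans i<j j<n))) (cong q pi≡b)) (trans (sym (qp j<n)) (cong q pj≡a)) i<j
    go : Dec (a < k) → Dec (b < k) → Mixed (a , b)
    go (yes a<k) (no b≮k)  = <ᵇ-true a<k , <ᵇ-false (≮⇒≥ b≮k)
    go (yes a<k) (yes b<k) = ⊥-elim (<-asym qb<qa (q-small a<b b<k))
    go (no a≮k)  _         = ⊥-elim (<-asym qb<qa (q-large (≮⇒≥ a≮k) a<b b<n))

  -- Read off from any reduced diagram of π, so that it need not be derived from π itself.
  Shuffled : Set
  Shuffled = ∀ c → keep c (upTo n) ≡ keep c word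

  -- Without repeats no swap is undone, so each letter is an inversion of the word of π and hence
  -- mixed. Mixed letters preserve both subsequences, which yields `Shuffled` on the way.
  reduced⇒mixed : ∀ {o L cs M} → catMaybes L ≡ upTo n → catMaybes M ≡ word → Trace o L cs M → T (noRepeat cs) →
    All (MixedLabels o) cs × Shuffled
  reduced⇒mixed {o} l m (trace C r perm) nr =
    All-resp-↭ perm (Allₚ.map⁺ (All.map (mixedLabels o _) mixed)) , λ c → keep-run c r′ mixed
    where
    r′ : Run (upTo n) C word
    r′ = subst₂ (λ L M → Run L C M) l m r
    unreversed : AllPairs Unreversed C
    unreversed = AllPairs.map (λ d (e , e′) → d (inj₂ (sym e′ , sym e))) (noRepeat⇒distinct o C perm nr)
    mixed : All Mixed C
    mixed = All.map (λ (u , v) → inversion-mixed u v) (All.zip (before-start r′ unreversed , before-end r′ unreversed))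

  -- The run keeps the small and the large subsequence, `Shuffled` identifies them with those of π,
  -- and the sizes of the exits fix how they interleave. In this way the exact exits are recovered
  -- from their sizes.
  mixed⇒reduced : ∀ {o L cs M} e → Shuffled → catMaybes L ≡ upTo n → catMaybes M ≡ applyUpTo e n →
    (∀ {i} → i < n → small (e i) ≡ small (p i)) → Trace o L cs M → All (MixedLabels o) cs →
    T (noRepeat cs) × (∀ {i} → i < n → e i ≡ p i)
  mixed⇒reduced {o} e sh l m cl (trace C r perm) ms =
    distinct⇒noRepeat o C perm (mixed-distinct (upTo⁺ n) r′ mixed) ,
    applyUpTo-injective n (shuffle-unique (applyUpTo e n) word
      (trans (map-applyUpTo e small n) (trans (applyUpTo-cong n λ _ → cl) (sym (map-applyUpTo p small n))))
      λ c → trans (sym (keep-run c r′ mixed)) (sh c))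
    where
    r′ : Run (upTo n) C (applyUpTo e n)
    r′ = subst₂ (λ L M → Run L C M) l m r
    mixed : All Mixed C
    mixed = All.map (mixedLabels⁻ o _) (Allₚ.map⁻ (All-resp-↭ (↭-sym perm) ms))

  small-complement : ∀ {d} → d < n → small (n ∸ suc d) ≡ not (d <ᵇ m)
  small-complement {d} d<n with d <? m
  ... | yes d<m = trans (<ᵇ-false (m+n≤o⇒m≤o∸n k
      (subst (k + suc d ≤_) (trans (+-comm k m) m+k≡n) (+-monoʳ-≤ k d<m)))) (cong not (sym (<ᵇ-true d<m)))
  ... | no  d≮m = trans (<ᵇ-true (subst₂ _≤_ (sym (suc∸suc d<n)) (trans (cong (_∸ m) (sym m+k≡n)) (m+n∸m≡n m k))
      (∸-monoʳ-≤ n (≮⇒≥ d≮m)))) (cong not (sym (<ᵇ-false (≮⇒≥ d≮m))))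

  -- Pipe dreams and configurations.

  module PipeDream (ψ : ℕ → ℕ → PTile) where

    X : ℕ → ℕ → PTile
    X i d = ψ i (n ∸ suc d)

    N : ℕ → ℕ → Label
    N zero    d = just (n ∸ suc d)
    N (suc i) d = south (X i) (N i) d

    E : ℕ → ℕ → Label
    E i d = east (X i) (N i) d

    initial : applyDownFrom (N 0) n ≡ applyUpTo just n
    initial = trans (applyDownFrom-cong n λ d _ → refl) (sym (applyUpTo-reversed just n))

    pdTrace-labels : pdTrace (grid ψ n) ≡ (applyUpTo (λ i → E i n) n , pGridCrossings n X N n)
    pdTrace-labels = trans (cong₂ pGrid
        (trans (rows-grid ψ n) (applyUpTo-cong n λ i _ → applyUpTo-reversed (ψ i) n))
        (trans (map-allFin just n) (sym initial)))
      (pGrid-labels n n X N (λ _ _ → refl))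

    module _ (shape : ∀ {i d} → i < n → d < n → X i d ≡ pcross → i < d) where

      -- With elbows only, `N (suc i) d` is `E i d` and `E i (suc d)` is `N i d`, so the pipes
      -- occupy exactly this triangle. A cross with `i < d` sits where both labels are present, and
      -- exchanging them does not change the pattern.
      just-N : ∀ i → i ≤ n → ∀ {d} → d < n → is-just (N i d) ≡ (i <ᵇ suc d)
      just-E : ∀ i → i < n → ∀ d → d ≤ n → is-just (E i d) ≡ (i <ᵇ d)
      just-N zero    _   d<n = refl
      just-N (suc i) i<n {d} d<n with X i d | shape i<n d<n
      ... | pelbow | _ = just-E i i<n d (<⇒≤ d<n)
      ... | pcross | h = trans (just-N i (<⇒≤ i<n) d<n) (trans (<ᵇ-true (m<n⇒m<1+n (h refl))) (sym (<ᵇ-true (h refl))))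
      just-E i i<n zero    _   = refl
      just-E i i<n (suc d) d<n with X i d | shape i<n d<n
      ... | pelbow | _ = just-N i (<⇒≤ i<n) d<n
      ... | pcross | h = trans (just-E i i<n d (<⇒≤ d<n)) (trans (<ᵇ-true (h refl)) (sym (<ᵇ-true (m<n⇒m<1+n (h refl)))))

      N-bottom : ∀ d → d < n → N n d ≡ nothing
      N-bottom d d<n = is-just-false⇒ (trans (just-N n ≤-refl d<n) (<ᵇ-false d<n))

      pd-trace : Trace true (applyDownFrom (N 0) n) (pGridCrossings n X N n)
        (applyUpTo (λ i → E i n) n ++ applyDownFrom (N n) n)
      pd-trace = pGrid-trace n n X N (λ _ _ → refl) λ i d i<n d<n e →
        trans (just-N i (<⇒≤ i<n) d<n) (<ᵇ-true (m<n⇒m<1+n (shape i<n d<n e))) ,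
        trans (just-E i i<n d (<⇒≤ d<n)) (<ᵇ-true (shape i<n d<n e))

      initial-word : catMaybes (applyDownFrom (N 0) n) ≡ upTo n
      initial-word = trans (cong catMaybes initial) (catMaybes-just id n)

      exit-word : ∀ e → (∀ {i} → i < n → E i n ≡ just (e i)) →
        catMaybes (applyUpTo (λ i → E i n) n ++ applyDownFrom (N n) n) ≡ applyUpTo e n
      exit-word e h = trans (catMaybes-++ (applyUpTo (λ i → E i n) n) _)
        (trans (cong₂ _++_ (trans (cong catMaybes (applyUpTo-cong n λ _ → h)) (catMaybes-just e n))
          (catMaybes-nothing↓ (N n) n N-bottom)) (++-identityʳ _))

      module _ (exit : ∀ {i} → i < n → E i n ≡ just (p i)) (nr : T (noRepeat (pGridCrossings n X N n))) where

        analysis : All (MixedLabels true) (pGridCrossings n X N n) × Shuffled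
        analysis = reduced⇒mixed {true} initial-word (exit-word p exit) pd-trace nr

        crossing-mixed : ∀ {i d} → i < n → d < n → X i d ≡ pcross → MixedLabels true (N i d , E i d)
        crossing-mixed i<n d<n e = All.lookup (proj₁ analysis) (∈-pGridCrossings n X N n i<n d<n e)

        -- The four patterns of sizes at an elbow give the four cells that are not blank, and a
        -- mixed cross gives the blank one.
        pd-cell : ∀ x nl e → (x ≡ pcross → MixedLabels true (nl , e)) →
          Cell (labelSmall e) (not (labelSmall nl)) (not (labelSmall (outS x nl e))) (labelSmall (outW x nl e))
          × isBlank (tileOf (labelSmall e) (not (labelSmall nl)) (not (labelSmall (outS x nl e)))) ≡ isPCross x
        pd-cell pcross nl e h with labelSmall nl | labelSmall e | h refl
        ... | _ | _ | refl , refl = blank , refl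
        pd-cell pelbow nl e h with labelSmall nl | labelSmall e
        ... | true  | true  = flat , refl
        ... | true  | false = elbow , refl
        ... | false | true  = jay , refl
        ... | false | false = down , refl

        pd-config : Cfg
        pd-config = record
          { V = λ i d → not (labelSmall (N i d))
          ; H = λ i d → labelSmall (E i d)
          ; top = λ d<n → trans (cong not (small-complement d<n)) (not-involutive _)
          ; left = λ _ → refl
          ; bottom = λ {d} d<n → cong (not ∘ labelSmall) (N-bottom d d<n)
          ; right = λ i<n → cong labelSmall (exit i<n)
          ; cell = λ {i} {d} i<n d<n → proj₁ (pd-cell (X i d) (N i d) (E i d) (crossing-mixed i<n d<n)) }

        pd-pd-config : pd pd-config ≡ grid ψ n
        pd-pd-config = grid-cong n λ i c i<n c<n → trans
          (cong crossIf (proj₂ (pd-cell (X i (n ∸ suc c)) _ _ (crossing-mixed i<n (complement< c<n)))))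
          (trans (crossIf-isPCross _) (cong (ψ i) (complement-involutive c<n)))
          where
          crossIf-isPCross : ∀ x → crossIf (isPCross x) ≡ x
          crossIf-isPCross pcross = refl
          crossIf-isPCross pelbow = refl

  module _ (C : Cfg) where
    open PipeDream (pTile C)

    X-pd : ∀ {i d} → d < n → X i d ≡ crossIf (isBlank (tl C i d))
    X-pd {i} d<n = cong (crossIf ∘ isBlank ∘ tl C i) (complement-involutive d<n)

    X-shape : ∀ {i d} → i < n → d < n → X i d ≡ pcross → i < d
    X-shape i<n d<n e with blank-edges (cell C i<n d<n) (crossIf⁻ (trans (sym (X-pd d<n)) e))
    -- The bottom edge of the blank cell, at height `suc i`, gives the strict inequality.
    ... | _ , (v , _) = unused-below-diagonal C i<n d<n v

    pd-class : ∀ {W N S E} → Cell W N S E → ∀ {nl e} → labelSmall nl ≡ not N → labelSmall e ≡ W →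
      labelSmall (outS (crossIf (isBlank (tileOf W N S))) nl e) ≡ not S ×
      labelSmall (outW (crossIf (isBlank (tileOf W N S))) nl e) ≡ E
    pd-class blank a b = a , b
    pd-class elbow a b = b , a
    pd-class down  a b = b , a
    pd-class flat  a b = b , a
    pd-class jay   a b = b , a

    class-N : ∀ i → i ≤ n → ∀ {d} → d < n → labelSmall (N i d) ≡ not (V C i d)
    class-E : ∀ i → i < n → ∀ d → d ≤ n → labelSmall (E i d) ≡ H C i d
    class-N zero    _   {d} d<n = trans (small-complement d<n) (cong not (sym (top C d<n)))
    class-N (suc i) i<n {d} d<n rewrite X-pd {i} d<n =
      proj₁ (pd-class (cell C i<n d<n) {N i d} {E i d} (class-N i (<⇒≤ i<n) d<n) (class-E i i<n d (<⇒≤ d<n)))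
    class-E i i<n zero    _   = sym (left C i<n)
    class-E i i<n (suc d) d<n rewrite X-pd {i} d<n =
      proj₂ (pd-class (cell C i<n d<n) {N i d} {E i d} (class-N i (<⇒≤ i<n) d<n) (class-E i i<n d (<⇒≤ d<n)))

    pd-shape : T (pdShape (pd C))
    pd-shape = pdShape⇐ (pd C) λ i j e → ¬⇒T-not λ le → ok i j (at-grid⁻ (pTile C) {n} e) (≤ᵇ⇒≤ (n ∸ 1) _ le)
      where
      ok : ∀ (i j : Fin n) → toℕ i < n × toℕ j < n × pTile C (toℕ i) (toℕ j) ≡ pcross → ¬ (n ∸ 1 ≤ toℕ i + toℕ j)
      ok i j (i<n , j<n , e) le = <⇒≱ (m+n≤o⇒m≤o∸n (suc (toℕ i + toℕ j)) (subst (_≤ n) (+-comm 1 (suc (toℕ i + toℕ j))) i+j<))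
        le
        where
        i<d : toℕ i < n ∸ suc (toℕ j)
        i<d with blank-edges (cell C i<n (complement< j<n)) (crossIf⁻ e)
        ... | _ , (v , _) = unused-below-diagonal C i<n (complement< j<n) v
        i+j< : suc (suc (toℕ i + toℕ j)) ≤ n
        i+j< = subst (_≤ n) (cong suc (+-suc (toℕ i) (toℕ j))) (m≤o∸n⇒m+n≤o (suc (toℕ i)) j<n i<d)

    pd-reduced : Shuffled → T (noRepeat (proj₂ (pdTrace (pd C)))) × proj₁ (pdTrace (pd C)) ≡ applyUpTo (just ∘ p) n
    pd-reduced sh = subst (λ t → T (noRepeat (proj₂ t)) × proj₁ t ≡ applyUpTo (just ∘ p) n) (sym pdTrace-labels)
      (proj₁ result , applyUpTo-cong n λ i i<n → trans (exit i<n) (cong just (proj₂ result i<n)))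
      where
      e : ℕ → ℕ
      e i = fromMaybe 0 (E i n)
      exit : ∀ {i} → i < n → E i n ≡ just (e i)
      exit {i} i<n = is-just⇒ (trans (just-E X-shape i i<n n ≤-refl) (<ᵇ-true i<n))
      result : T (noRepeat (pGridCrossings n X N n)) × (∀ {i} → i < n → e i ≡ p i)
      result = mixed⇒reduced {true} e sh (initial-word X-shape) (exit-word X-shape e exit)
        (λ {i} i<n → trans (sym (cong labelSmall (exit i<n))) (trans (class-E i i<n n ≤-refl) (right C i<n)))
        (pd-trace X-shape) (all-pGridCrossings n X N n λ i d i<n d<n x → mixed i<n d<n (crossIf⁻ (trans (sym (X-pd d<n)) x)))
        where
        mixed : ∀ {i d} → i < n → d < n → isBlank (tl C i d) ≡ true → MixedLabels true (N i d , E i d)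
        mixed {i} {d} i<n d<n b with blank-edges (cell C i<n d<n) b
        ... | (h , v) , _ = trans (class-N i (<⇒≤ i<n) d<n) (cong not v) , trans (class-E i i<n d (<⇒≤ d<n)) h

  -- `p i < j` says that the tile lies to the right of the corner of its row, `q j < i` that it lies
  -- below the corner of its column. Equality holds in both comparisons or in neither, and
  -- `large-order` rules out the blank pattern.
  rothe-cell : ∀ {i j} → i < n → k ≤ j → j < n →
    RotheCell (p i <ᵇ j) (q j <ᵇ i) (q j <ᵇ suc i) (p i <ᵇ suc j)
  rothe-cell {i} {j} i<n k≤j j<n with <-cmp (p i) j | <-cmp (q j) i
  ... | tri< pi<j _ _ | tri< qj<i _ _
    rewrite <ᵇ-true pi<j | <ᵇ-true (m<n⇒m<1+n pi<j) | <ᵇ-true qj<i | <ᵇ-true (m<n⇒m<1+n qj<i) = crossing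
  ... | tri< pi<j pi≢j _ | tri≈ _ qj≡i _ = ⊥-elim (pi≢j (trans (cong p (sym qj≡i)) (pq j<n)))
  ... | tri< pi<j _ _ | tri> _ _ i<qj
    rewrite <ᵇ-true pi<j | <ᵇ-true (m<n⇒m<1+n pi<j) | <ᵇ-false (<⇒≤ i<qj) | <ᵇ-false {q j} {suc i} i<qj = across
  ... | tri≈ _ refl _ | _
    rewrite qp i<n | <ᵇ-true (n<1+n i) | <ᵇ-true (n<1+n (p i)) | <ᵇ-false (≤-refl {i}) | <ᵇ-false (≤-refl {p i}) = corner
  ... | tri> _ pi≢j j<pi | tri≈ _ qj≡i _ = ⊥-elim (pi≢j (trans (cong p (sym qj≡i)) (pq j<n)))
  ... | tri> _ _ j<pi | tri< qj<i _ _
    rewrite <ᵇ-false (<⇒≤ j<pi) | <ᵇ-false {p i} {suc j} j<pi | <ᵇ-true qj<i | <ᵇ-true (m<n⇒m<1+n qj<i) = vertical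
  ... | tri> _ _ j<pi | tri> _ _ i<qj = ⊥-elim (<⇒≱ i<qj (large-order i<n k≤j j<n (<⇒≤ j<pi)))

  -- Bumpless pipe dreams and configurations.

  module Bumpless (t : ℕ → ℕ → BTile) where

    west : (ℕ → BTile) → (ℕ → Label) → ℕ → Label
    west r s zero    = nothing
    west r s (suc j) = outE (r j) (s j) (west r s j)

    -- Labels come from the south, so the recursion is on the number of rows below; `N` translates
    -- back to row indices.
    fromBottom : ℕ → ℕ → Label
    fromBottom zero    j = just j
    fromBottom (suc u) j = outN (t (n ∸ suc u) j) (fromBottom u j) (west (t (n ∸ suc u)) (fromBottom u) j)

    N W : ℕ → ℕ → Label
    N i = fromBottom (n ∸ i)
    W i = west (t i) (N (suc i))

    N-bottom : ∀ j → N n j ≡ just j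
    N-bottom j rewrite n∸n≡0 n = refl

    N-step : ∀ i j → i < n → N i j ≡ outN (t i j) (N (suc i) j) (W i j)
    N-step i j i<n = trans (cong (λ u → fromBottom u j) (sym (suc∸suc i<n)))
      (cong (λ a → outN (t a j) (N (suc i) j) (west (t a) (N (suc i)) j)) (complement-involutive i<n))

    -- The south and west borders together with the tile rule determine a Boolean attribute of the
    -- labels everywhere. It is applied to presence and to smallness.
    module _ (f : Label → Bool) (FN FW : ℕ → ℕ → Bool)
      (bottom : ∀ j → j < n → f (just j) ≡ FN n j) (left : ∀ i → i < n → f nothing ≡ FW i 0)
      (step : ∀ {i j s w} → i < n → j < n → f s ≡ FN (suc i) j → f w ≡ FW i j →
        f (outN (t i j) s w) ≡ FN i j × f (outE (t i j) s w) ≡ FW i (suc j)) where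

      propagate-row : ∀ i → i < n → (∀ j → j < n → f (N (suc i) j) ≡ FN (suc i) j) → ∀ j → j ≤ n → f (W i j) ≡ FW i j
      propagate-row i i<n h zero    _   = left i i<n
      propagate-row i i<n h (suc j) j<n = proj₂ (step i<n j<n (h j j<n) (propagate-row i i<n h j (<⇒≤ j<n)))

      propagate-N : ∀ i → i ≤ n → ∀ j → j < n → f (N i j) ≡ FN i j
      propagate-N i = descend {P = λ i → ∀ j → j < n → f (N i j) ≡ FN i j} n
        (λ j j<n → trans (cong f (N-bottom j)) (bottom j j<n))
        (λ i _ i<n h j j<n → trans (cong f (N-step i j i<n))
          (proj₁ (step i<n j<n (h j j<n) (propagate-row i i<n h j (<⇒≤ j<n))))) i z≤n

      propagate-W : ∀ i → i < n → ∀ j → j ≤ n → f (W i j) ≡ FW i j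
      propagate-W i i<n = propagate-row i i<n (propagate-N (suc i) i<n)

    bpdTrace-labels : bpdTrace (grid t n) ≡ (applyUpTo (λ i → W i n) n , gridCrossings n t N W n)
    bpdTrace-labels
      rewrite rows-grid t n | map-allFin just n | sym (applyUpTo-cong n (λ j _ → N-bottom j))
            | bGrid-labels n n t N W (λ _ → refl) (λ _ _ _ → refl) (λ i j → N-step i j) = refl

    module _ (agrees : ∀ i j → i < n → j < n → Agrees (t i j) (N (suc i) j) (W i j))
      (top-empty : ∀ j → j < n → N 0 j ≡ nothing) where

      bpd-trace : Trace false (applyUpTo (N n) n) (gridCrossings n t N W n) (applyUpTo (N 0) n ++ applyUpTo (λ i → W i n) n)
      bpd-trace = grid-trace n n t N W (λ _ → refl) (λ _ _ _ → refl) (λ i j → N-step i j) agrees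

      initial-word : catMaybes (applyUpTo (N n) n) ≡ upTo n
      initial-word = trans (cong catMaybes (applyUpTo-cong n λ j _ → N-bottom j)) (catMaybes-just id n)

      exit-word : ∀ e → (∀ {i} → i < n → W i n ≡ just (e i)) →
        catMaybes (applyUpTo (N 0) n ++ applyUpTo (λ i → W i n) n) ≡ applyUpTo e n
      exit-word e h = trans (catMaybes-++ (applyUpTo (N 0) n) _) (cong₂ _++_
        (catMaybes-nothing (N 0) n top-empty) (trans (cong catMaybes (applyUpTo-cong n λ _ → h)) (catMaybes-just e n)))

    module _ (shape : T (bpdShape (grid t n))) (0<n : 0 < n) where

      shape-parts = ∧-split {all rowOK (rows (grid t n))} shape

      row-shape : ∀ i → i < n → (∀ j → j < n → edgeS (t i j) ≡ is-just (N (suc i) j)) →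
        ∀ j → j < n → edgeW (t i j) ≡ is-just (W i j)
      row-shape i i<n hS = proj₁ (rowOK⇒ n (t i) (is-just ∘ W i) 0<n
        (all-applyUpTo rowOK _ n (subst (λ rs → T (all rowOK rs)) (rows-grid t n) (proj₁ shape-parts)) i<n) refl
        λ j j<n e → is-just-outE (t i j) (sym (hS j j<n) , sym e))

      column-shape : (∀ i j → i < n → j < n → edgeS (t i j) ≡ is-just (N (suc i) j)) × (∀ j → j < n → is-just (N 0 j) ≡ false)
      column-shape = colsOK⇒ n n t (λ i j → is-just (N i j)) 0<n
        (subst (λ rs → T (colsOK rs)) (rows-grid t n) (proj₂ shape-parts)) (λ j _ → cong is-just (N-bottom j))
        λ i i<n hS j j<n → trans (cong is-just (N-step i j i<n))
          (is-just-outN (t i j) (sym (hS j j<n) , sym (row-shape i i<n hS j j<n)))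

      shape-agrees : ∀ i j → i < n → j < n → Agrees (t i j) (N (suc i) j) (W i j)
      shape-agrees i j i<n j<n = sym (proj₁ column-shape i j i<n j<n) ,
        sym (row-shape i i<n (λ j → proj₁ column-shape i j i<n) j j<n)

    module _ (agrees : ∀ i j → i < n → j < n → Agrees (t i j) (N (suc i) j) (W i j))
      (top-empty : ∀ j → j < n → N 0 j ≡ nothing)
      (exit : ∀ {i} → i < n → W i n ≡ just (p i)) (nr : T (noRepeat (gridCrossings n t N W n))) where

      bpd-analysis : All (MixedLabels false) (gridCrossings n t N W n) × Shuffled
      bpd-analysis = reduced⇒mixed {false} (initial-word agrees top-empty) (exit-word agrees top-empty p exit)
        (bpd-trace agrees top-empty) nr

      bpd-mixed : ∀ i j → i < n → j < n → t i j ≡ bcross → MixedLabels false (N (suc i) j , W i j)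
      bpd-mixed i j i<n j<n e = All.lookup (proj₁ bpd-analysis) (∈-gridCrossings n t N W n i<n j<n e)

      RotheW RotheN : ℕ → Set
      RotheW j = ∀ i → i < n → W i j ≡ labelIf (p i <ᵇ j) (p i)
      RotheN j = ∀ i → i ≤ n → N i j ≡ labelIf (q j <ᵇ i) j

      forced : ∀ i j → i < n → k ≤ j → j < n → W i (suc j) ≡ labelIf (p i <ᵇ suc j) (p i) →
        N (suc i) j ≡ labelIf (q j <ᵇ suc i) j →
        W i j ≡ labelIf (p i <ᵇ j) (p i) × outN (t i j) (N (suc i) j) (W i j) ≡ labelIf (q j <ᵇ i) j
      forced i j i<n k≤j j<n e s = rothe-forced (t i j) (rothe-cell i<n k≤j j<n) (agrees i j i<n j<n) s e
        (λ pi<j → <⇒≢ (<ᵇ-true⁻ pi<j)) corner-value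
        -- In a mixed crossing the pipe from the west is small, so it cannot be the large pipe `j`.
        λ c w → not-small (trans (sym (cong labelSmall w)) (proj₁ (bpd-mixed i j i<n j<n c)))
        where
        not-small : labelSmall (just j) ≢ true
        not-small h with () ← trans (sym h) (<ᵇ-false k≤j)
        corner-value : (p i <ᵇ j) ≡ false → p i ≡ j ⊎ (p i <ᵇ suc j) ≡ false
        corner-value h with m≤n⇒m<n∨m≡n (<ᵇ-false⁻ h)
        ... | inj₁ j<pi = inj₂ (<ᵇ-false j<pi)
        ... | inj₂ j≡pi = inj₁ (sym j≡pi)

      rothe-N : ∀ j → k ≤ j → j < n → RotheW (suc j) → RotheN j
      rothe-N j k≤j j<n h i = descend {P = λ i → N i j ≡ labelIf (q j <ᵇ i) j} n
        (trans (N-bottom j) (cong (λ b → labelIf b j) (sym (<ᵇ-true (q< j<n)))))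
        (λ i _ i<n s → trans (N-step i j i<n) (proj₂ (forced i j i<n k≤j j<n (h i i<n) s))) i z≤n

      rothe-W : ∀ j → k ≤ j → j ≤ n → RotheW j
      rothe-W = descend {P = RotheW} n
        (λ i i<n → trans (exit i<n) (cong (λ b → labelIf b (p i)) (sym (<ᵇ-true (p< i<n)))))
        λ j k≤j j<n h i i<n → proj₁ (forced i j i<n k≤j j<n (h i i<n) (rothe-N j k≤j j<n h (suc i) i<n))

      -- Pipes only go north and east, so those met in the columns below `k` also started there and
      -- are small.
      left-class-W : ∀ i → i < n → (∀ j → j < k → labelSmall (N (suc i) j) ≡ is-just (N (suc i) j)) →
        ∀ j → j ≤ k → labelSmall (W i j) ≡ is-just (W i j)
      left-class-W i i<n h zero    _   = refl
      left-class-W i i<n h (suc j) j<k = proj₂ (uncrossed-out {labelSmall} (t i j) refl (h j j<k) (left-class-W i i<n h j (<⇒≤ j<k)))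

      left-class-N : ∀ i → i ≤ n → ∀ j → j < k → labelSmall (N i j) ≡ is-just (N i j)
      left-class-N i = descend {P = λ i → ∀ j → j < k → labelSmall (N i j) ≡ is-just (N i j)} n
        (λ j j<k → trans (cong labelSmall (N-bottom j)) (trans (<ᵇ-true j<k) (sym (cong is-just (N-bottom j)))))
        (λ i _ i<n h j j<k → subst (λ x → labelSmall x ≡ is-just x) (sym (N-step i j i<n))
          (proj₁ (uncrossed-out {labelSmall} (t i j) refl (h j j<k) (left-class-W i i<n h j (<⇒≤ j<k))))) i z≤n

      -- A mixed crossing would need a large pipe coming from the south.
      left-uncrossed : ∀ i j → i < n → j < k → t i j ≢ bcross
      left-uncrossed i j i<n j<k e with () ← trans (sym (proj₂ (bpd-mixed i j i<n (≤-trans j<k k≤n) e)))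
        (trans (left-class-N (suc i) i<n j j<k) (trans (proj₁ (agrees i j i<n (≤-trans j<k k≤n))) (cong edgeS e)))

      edge-N : ∀ i j → i < n → j < n → is-just (N i j) ≡ edgeN (t i j)
      edge-N i j i<n j<n = trans (cong is-just (N-step i j i<n)) (is-just-outN (t i j) (agrees i j i<n j<n))

      edge-E : ∀ i j → i < n → j < n → is-just (W i (suc j)) ≡ edgeE (t i j)
      edge-E i j i<n j<n = is-just-outE (t i j) (agrees i j i<n j<n)

      left-cell : ∀ i j → i < n → j < k →
        Cell (is-just (W i j)) (is-just (N i j)) (is-just (N (suc i) j)) (is-just (W i (suc j)))
      left-cell i j i<n j<k
        rewrite edge-N i j i<n (≤-trans j<k k≤n) | edge-E i j i<n (≤-trans j<k k≤n)
              | proj₁ (agrees i j i<n (≤-trans j<k k≤n)) | proj₂ (agrees i j i<n (≤-trans j<k k≤n)) =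
        uncrossed-cell (t i j) (left-uncrossed i j i<n j<k)

      padV padH : ℕ → ℕ → Bool
      padV i d = if d <ᵇ m then true else is-just (N i (d ∸ m))
      padH i d = if d <ᵇ m then false else is-just (W i (d ∸ m))

      padV-left : ∀ i {d} → d < m → padV i d ≡ true
      padV-left i d<m rewrite <ᵇ-true d<m = refl

      padV-right : ∀ i j → padV i (m + j) ≡ is-just (N i j)
      padV-right i j rewrite <ᵇ-false (m≤m+n m j) | m+n∸m≡n m j = refl

      padH-right : ∀ i j → padH i (m + j) ≡ is-just (W i j)
      padH-right i j rewrite <ᵇ-false (m≤m+n m j) | m+n∸m≡n m j = refl

      padH-left : ∀ i {d} → d ≤ m → padH i d ≡ false
      padH-left i {d} d≤m with m≤n⇒m<n∨m≡n d≤m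
      ... | inj₁ d<m rewrite <ᵇ-true d<m = refl
      ... | inj₂ refl rewrite <ᵇ-false (≤-refl {m}) | n∸n≡0 m = refl

      bpd-config : Cfg
      bpd-config = record
        { V = padV ; H = padH
        ; top = λ {d} d<n → top′ (column d) d<n
        ; left = λ {i} _ → padH-left i z≤n
        ; bottom = λ {d} _ → bottom′ (column d)
        -- At column `k` the Rothe pattern says that row `i` is used iff `p i < k`.
        ; right = λ {i} i<n → trans (trans (cong (padH i) (sym m+k≡n)) (padH-right i k))
            (trans (cong is-just (rothe-W k ≤-refl k≤n i i<n)) (is-just-labelIf (p i <ᵇ k) (p i)))
        ; cell = λ {i} {d} i<n d<n → cell′ i i<n (column d) d<n }
        where
        top′ : ∀ {d} → d < m ⊎ (∃ λ j → d ≡ m + j) → d < n → padV 0 d ≡ (d <ᵇ m)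
        top′ (inj₁ d<m) _ = trans (padV-left 0 d<m) (sym (<ᵇ-true d<m))
        top′ (inj₂ (j , refl)) d<n = trans (padV-right 0 j)
          (trans (cong is-just (top-empty j (≤-trans (unshift< d<n) k≤n))) (sym (<ᵇ-false (m≤m+n m j))))
        bottom′ : ∀ {d} → d < m ⊎ (∃ λ j → d ≡ m + j) → padV n d ≡ true
        bottom′ (inj₁ d<m) = padV-left n d<m
        bottom′ (inj₂ (j , refl)) = trans (padV-right n j) (cong is-just (N-bottom j))
        cell′ : ∀ i → i < n → ∀ {d} → d < m ⊎ (∃ λ j → d ≡ m + j) → d < n →
          Cell (padH i d) (padV i d) (padV (suc i) d) (padH i (suc d))
        cell′ i i<n (inj₁ d<m) _ rewrite padH-left i (<⇒≤ d<m) | padV-left i d<m | padV-left (suc i) d<m | padH-left i d<m = down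
        cell′ i i<n (inj₂ (j , refl)) d<n with unshift< {j} d<n
        ... | j<k rewrite sym (+-suc m j) | padH-right i j | padV-right i j | padV-right (suc i) j | padH-right i (suc j) =
          left-cell i j i<n j<k

      bpd-bpd-config : bpd bpd-config ≡ grid t n
      bpd-bpd-config = grid-cong n λ i j i<n j<n → eq i j i<n j<n (j <? k)
        where
        edges : ∀ i j → i < n → j < n → tileOf (is-just (W i j)) (is-just (N i j)) (is-just (N (suc i) j)) ≡ t i j
        edges i j i<n j<n rewrite edge-N i j i<n j<n | proj₁ (agrees i j i<n j<n) | proj₂ (agrees i j i<n j<n) = tileOf-edges (t i j)
        eq : ∀ i j → i < n → j < n → Dec (j < k) → bTile bpd-config i j ≡ t i j
        eq i j i<n j<n (yes j<k) = trans (bTile-left bpd-config j<k) (trans tl≡ (edges i j i<n j<n))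
          where
          tl≡ : tl bpd-config i (m + j) ≡ tileOf (is-just (W i j)) (is-just (N i j)) (is-just (N (suc i) j))
          tl≡ rewrite padH-right i j | padV-right i j | padV-right (suc i) j = refl
        eq i j i<n j<n (no j≮k) = trans (bTile-right bpd-config k≤j) (trans (sym rothe≡) (edges i j i<n j<n))
          where
          k≤j = ≮⇒≥ j≮k
          N-rothe = rothe-N j k≤j j<n (rothe-W (suc j) (m≤n⇒m≤1+n k≤j) j<n)
          rothe≡ : tileOf (is-just (W i j)) (is-just (N i j)) (is-just (N (suc i) j)) ≡ rothe i j
          rothe≡ rewrite rothe-W j k≤j (<⇒≤ j<n) i i<n | N-rothe i (<⇒≤ i<n) | N-rothe (suc i) i<n
            | is-just-labelIf (p i <ᵇ j) (p i) | is-just-labelIf (q j <ᵇ i) j | is-just-labelIf (q j <ᵇ suc i) j = refl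

  module _ (C : Cfg) where
    open Bumpless (bTile C)

    -- In the columns below `k` every used edge carries a small pipe, so both predictions coincide;
    -- further right they differ. There `smallW` is the size of the exit even where the row is not
    -- yet used, which is consistent because then `k ≤ j ≤ p i`.
    usedN usedW smallN smallW : ℕ → ℕ → Bool
    usedN  i j = if j <ᵇ k then V C i (m + j) else q j <ᵇ i
    usedW  i j = if j <ᵇ k then H C i (m + j) else p i <ᵇ j
    smallN i j = if j <ᵇ k then V C i (m + j) else false
    smallW i j = if j <ᵇ k then H C i (m + j) else small (p i)

    H-boundary : ∀ {i} → i < n → H C i (m + k) ≡ small (p i)
    H-boundary {i} i<n = trans (cong (H C i) m+k≡n) (right C i<n)

    H-left : ∀ {i} → i < n → H C i (m + 0) ≡ false
    H-left {i} i<n = trans (cong (H C i) (+-identityʳ m)) (proj₂ (padding C m≤n (<⇒≤ i<n)) i<n m ≤-refl)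

    V-top : ∀ {j} → j < k → V C 0 (m + j) ≡ false
    V-top {j} j<k = trans (top C (shift< j<k)) (<ᵇ-false (m≤m+n m j))

    usedW-left : ∀ {i j} → i < n → j ≤ k → usedW i j ≡ H C i (m + j)
    usedW-left {i} {j} i<n j≤k with m≤n⇒m<n∨m≡n j≤k
    ... | inj₁ j<k rewrite <ᵇ-true j<k = refl
    ... | inj₂ refl rewrite <ᵇ-false (≤-refl {k}) = sym (H-boundary i<n)

    smallW-left : ∀ {i j} → i < n → j ≤ k → smallW i j ≡ H C i (m + j)
    smallW-left {i} {j} i<n j≤k with m≤n⇒m<n∨m≡n j≤k
    ... | inj₁ j<k rewrite <ᵇ-true j<k = refl
    ... | inj₂ refl rewrite <ᵇ-false (≤-refl {k}) = sym (H-boundary i<n)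

    config-cell : ∀ {i j} → i < n → j < k → Cell (H C i (m + j)) (V C i (m + j)) (V C (suc i) (m + j)) (H C i (m + suc j))
    config-cell {i} {j} i<n j<k rewrite +-suc m j = cell C i<n (shift< j<k)

    used-step : ∀ {i j s w} → i < n → j < n → is-just s ≡ usedN (suc i) j → is-just w ≡ usedW i j →
      is-just (outN (bTile C i j) s w) ≡ usedN i j × is-just (outE (bTile C i j) s w) ≡ usedW i (suc j)
    used-step {i} {j} i<n j<n a b with j <? k
    ... | yes j<k rewrite usedW-left i<n j<k | <ᵇ-true j<k = outgoing {f = is-just} refl (config-cell i<n j<k) a b
    ... | no  j≮k rewrite <ᵇ-false (≮⇒≥ j≮k) | <ᵇ-false (m≤n⇒m≤1+n (≮⇒≥ j≮k)) =
      rothe-agrees (rothe-cell i<n (≮⇒≥ j≮k) j<n) a b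

    small-step : ∀ {i j s w} → i < n → j < n → labelSmall s ≡ smallN (suc i) j → labelSmall w ≡ smallW i j →
      labelSmall (outN (bTile C i j) s w) ≡ smallN i j × labelSmall (outE (bTile C i j) s w) ≡ smallW i (suc j)
    small-step {i} {j} i<n j<n a b with j <? k
    ... | yes j<k rewrite smallW-left i<n j<k | <ᵇ-true j<k = outgoing {f = labelSmall} refl (config-cell i<n j<k) a b
    ... | no  j≮k rewrite <ᵇ-false (≮⇒≥ j≮k) | <ᵇ-false (m≤n⇒m≤1+n (≮⇒≥ j≮k)) =
      rothe-class {f = labelSmall} refl (rothe-cell i<n (≮⇒≥ j≮k) j<n) a b
        λ pi≥j _ → <ᵇ-false (≤-trans (≮⇒≥ j≮k) (<ᵇ-false⁻ pi≥j))

    usedN-bottom : ∀ j → j < n → true ≡ usedN n j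
    usedN-bottom j j<n with j <? k
    ... | yes j<k rewrite <ᵇ-true j<k = sym (bottom C (shift< j<k))
    ... | no  j≮k rewrite <ᵇ-false (≮⇒≥ j≮k) = sym (<ᵇ-true (q< j<n))

    smallN-bottom : ∀ j → j < n → small j ≡ smallN n j
    smallN-bottom j j<n with j <? k
    ... | yes j<k rewrite <ᵇ-true j<k = sym (bottom C (shift< j<k))
    ... | no  j≮k rewrite <ᵇ-false (≮⇒≥ j≮k) = refl

    usedW-start : ∀ i → i < n → false ≡ usedW i 0
    usedW-start i i<n = sym (trans (usedW-left i<n z≤n) (H-left i<n))

    smallW-start : ∀ i → i < n → false ≡ smallW i 0
    smallW-start i i<n = sym (trans (smallW-left i<n z≤n) (H-left i<n))

    usedN-top : ∀ j → j < n → usedN 0 j ≡ false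
    usedN-top j j<n with j <? k
    ... | yes j<k rewrite <ᵇ-true j<k = V-top j<k
    ... | no  j≮k rewrite <ᵇ-false (≮⇒≥ j≮k) = refl

    usedW-end : ∀ i → i < n → usedW i n ≡ true
    usedW-end i i<n rewrite <ᵇ-false k≤n = <ᵇ-true (p< i<n)

    used-N = propagate-N is-just usedN usedW usedN-bottom usedW-start used-step
    used-W = propagate-W is-just usedN usedW usedN-bottom usedW-start used-step
    small-N = propagate-N labelSmall smallN smallW smallN-bottom smallW-start small-step
    small-W = propagate-W labelSmall smallN smallW smallN-bottom smallW-start small-step

    tile-edges : ∀ i j → i < n → j < n →
      (edgeW (bTile C i j) ≡ usedW i j × edgeN (bTile C i j) ≡ usedN i j) ×
      (edgeS (bTile C i j) ≡ usedN (suc i) j × edgeE (bTile C i j) ≡ usedW i (suc j))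
    tile-edges i j i<n j<n with j <? k
    ... | yes j<k rewrite usedW-left i<n j<k | <ᵇ-true j<k =
      let c = config-cell i<n j<k in (cell-W c , cell-N c) , (cell-S c , cell-E c)
    ... | no  j≮k rewrite <ᵇ-false (≮⇒≥ j≮k) | <ᵇ-false (m≤n⇒m≤1+n (≮⇒≥ j≮k)) =
      edges-rothe (rothe-cell i<n (≮⇒≥ j≮k) j<n)

    bpd-shape : T (bpdShape (bpd C))
    bpd-shape = ∧-pair
      (subst (λ rs → T (all rowOK rs)) (sym (rows-grid (bTile C) n)) (all-applyUpTo⁺ rowOK _ n λ i i<n →
        rowOK⇐ n (bTile C i) (usedW i) (sym (usedW-start i i<n))
          (λ j j<n → proj₁ (proj₁ (tile-edges i j i<n j<n))) (λ j j<n → proj₂ (proj₂ (tile-edges i j i<n j<n)))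
          (usedW-end i i<n)))
      (subst (λ rs → T (colsOK rs)) (sym (rows-grid (bTile C) n)) (colsOK⇐ n n (bTile C) usedN
        (λ j j<n → sym (usedN-bottom j j<n)) usedN-top
        (λ i j i<n j<n → proj₂ (proj₁ (tile-edges i j i<n j<n)))
        (λ i j i<n j<n → proj₁ (proj₂ (tile-edges i j i<n j<n)))))

    bpd-agrees : ∀ i j → i < n → j < n → Agrees (bTile C i j) (N (suc i) j) (W i j)
    bpd-agrees i j i<n j<n = trans (used-N (suc i) i<n j j<n) (sym (proj₁ (proj₂ (tile-edges i j i<n j<n)))) ,
      trans (used-W i i<n j (<⇒≤ j<n)) (sym (proj₁ (proj₁ (tile-edges i j i<n j<n))))

    crossing-mixed : ∀ i j → i < n → j < n → bTile C i j ≡ bcross → MixedLabels false (N (suc i) j , W i j)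
    crossing-mixed i j i<n j<n e with j <? k
    ... | yes j<k = ⊥-elim (uncrossed (config-cell i<n j<k) (trans (sym (bTile-left C j<k)) e))
      where
      uncrossed : ∀ {W N S E} → Cell W N S E → tileOf W N S ≢ bcross
      uncrossed blank ()
      uncrossed elbow ()
      uncrossed down  ()
      uncrossed flat  ()
      uncrossed jay   ()
    ... | no j≮k with small-W i i<n j (<⇒≤ j<n) | small-N (suc i) i<n j j<n
    ...   | w | s rewrite <ᵇ-false (≮⇒≥ j≮k) = trans w (crossing-small (rothe-cell i<n (≮⇒≥ j≮k) j<n) refl refl e) , s
      where
      -- At a crossing `p i < j` and `q j < i`. If `p i` were large, `q` would increase from `p i`
      -- to `j` and give `i < q j`.
      crossing-small : ∀ {W N S E} → RotheCell W N S E → W ≡ (p i <ᵇ j) → N ≡ (q j <ᵇ i) → tileOf W N S ≡ bcross → small (p i) ≡ true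
      crossing-small crossing pi<j qj<i _ with p i <? k
      ... | yes pi<k = <ᵇ-true pi<k
      ... | no  pi≮k = ⊥-elim (<-asym (<ᵇ-true⁻ {q j} (sym qj<i))
        (subst (_< q j) (qp i<n) (q-large (≮⇒≥ pi≮k) (<ᵇ-true⁻ (sym pi<j)) j<n)))

    bpd-reduced : Shuffled → T (noRepeat (proj₂ (bpdTrace (bpd C)))) × proj₁ (bpdTrace (bpd C)) ≡ applyUpTo (just ∘ p) n
    bpd-reduced sh = subst (λ t → T (noRepeat (proj₂ t)) × proj₁ t ≡ applyUpTo (just ∘ p) n) (sym bpdTrace-labels)
      (proj₁ result , applyUpTo-cong n λ i i<n → trans (exit i<n) (cong just (proj₂ result i<n)))
      where
      e : ℕ → ℕ
      e i = fromMaybe 0 (W i n)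
      exit : ∀ {i} → i < n → W i n ≡ just (e i)
      exit {i} i<n = is-just⇒ (trans (used-W i i<n n ≤-refl) (usedW-end i i<n))
      top-empty : ∀ j → j < n → N 0 j ≡ nothing
      top-empty j j<n = is-just-false⇒ (trans (used-N 0 z≤n j j<n) (usedN-top j j<n))
      end-class : ∀ i → smallW i n ≡ small (p i)
      end-class i rewrite <ᵇ-false k≤n = refl
      result : T (noRepeat (gridCrossings n (bTile C) N W n)) × (∀ {i} → i < n → e i ≡ p i)
      result = mixed⇒reduced {false} e sh (initial-word bpd-agrees top-empty) (exit-word bpd-agrees top-empty e exit)
        (λ {i} i<n → trans (sym (cong labelSmall (exit i<n))) (trans (small-W i i<n n ≤-refl) (end-class i)))
        (bpd-trace bpd-agrees top-empty) (all-gridCrossings n (bTile C) N W n crossing-mixed)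

  -- Decoding valid diagrams, and the bijection.

  ValidB : BGrid n → Set
  ValidB D = T (bpdShape D) × T (noRepeat (proj₂ (bpdTrace D))) × proj₁ (bpdTrace D) ≡ applyUpTo (just ∘ p) n

  ValidP : PGrid n → Set
  ValidP D = T (pdShape D) × T (noRepeat (proj₂ (pdTrace D))) × proj₁ (pdTrace D) ≡ applyUpTo (just ∘ p) n

  bpd-decode : ∀ D → ValidB D → Shuffled × ∃ λ C → bpd C ≡ D
  bpd-decode D v = subst (λ D → Shuffled × ∃ λ C → bpd C ≡ D) (grid-entry bblank D)
    (decode (entry bblank D) (subst ValidB (sym (grid-entry bblank D)) v))
    where
    decode : ∀ t → ValidB (grid t n) → Shuffled × ∃ λ C → bpd C ≡ grid t n
    decode t (shape , nr , ex) = proj₂ (bpd-analysis agrees top-empty exit nr′) ,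
      bpd-config agrees top-empty exit nr′ , bpd-bpd-config agrees top-empty exit nr′
      where
      open Bumpless t
      agrees : ∀ i j → i < n → j < n → Agrees (t i j) (N (suc i) j) (W i j)
      agrees i j i<n = shape-agrees shape (≤-trans z<s i<n) i j i<n
      top-empty : ∀ j → j < n → N 0 j ≡ nothing
      top-empty j j<n = is-just-false⇒ (proj₂ (column-shape shape (≤-trans z<s j<n)) j j<n)
      exit : ∀ {i} → i < n → W i n ≡ just (p i)
      exit = applyUpTo-injective n (trans (cong proj₁ (sym bpdTrace-labels)) ex)
      nr′ : T (noRepeat (gridCrossings n t N W n))
      nr′ = subst (λ c → T (noRepeat (proj₂ c))) bpdTrace-labels nr

  pd-decode : ∀ D → ValidP D → Shuffled × ∃ λ C → pd C ≡ D
  pd-decode D v = subst (λ D → Shuffled × ∃ λ C → pd C ≡ D) (grid-entry pelbow D)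
    (decode (entry pelbow D) (subst ValidP (sym (grid-entry pelbow D)) v))
    where
    decode : ∀ ψ → ValidP (grid ψ n) → Shuffled × ∃ λ C → pd C ≡ grid ψ n
    decode ψ (shape , nr , ex) = proj₂ (analysis shape′ exit nr′) ,
      pd-config shape′ exit nr′ , pd-pd-config shape′ exit nr′
      where
      open PipeDream ψ
      shape′ : ∀ {i d} → i < n → d < n → X i d ≡ pcross → i < d
      -- If `d ≤ i`, then `i + (n ∸ suc d)` is at least `n ∸ 1`, where the shape test forbids a
      -- cross.
      shape′ {i} {d} i<n d<n e = ≰⇒> λ d≤i → T-not⇒¬ (pdShape⇒ (grid ψ n) shape (fromℕ< i<n) (fromℕ< (complement< d<n)) at≡)
        (≤⇒≤ᵇ (subst₂ (λ a b → n ∸ 1 ≤ a + b) (sym (toℕ-fromℕ< i<n)) (sym (toℕ-fromℕ< (complement< d<n)))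
          (≤-trans (subst (n ∸ 1 ≤_) (sum d<n) ≤-refl) (+-monoˡ-≤ (n ∸ suc d) d≤i))))
        where
        sum : ∀ {n d} → d < n → n ∸ 1 ≡ d + (n ∸ suc d)
        sum {suc n} {d} d<n = sym (m+[n∸m]≡n (s≤s⁻¹ d<n))
        at≡ : at (grid ψ n) (toℕ (fromℕ< i<n)) (toℕ (fromℕ< (complement< d<n))) ≡ just pcross
        at≡ rewrite toℕ-fromℕ< i<n | toℕ-fromℕ< (complement< d<n) = trans (at-grid ψ i<n (complement< d<n)) (cong just e)
      exit : ∀ {i} → i < n → E i n ≡ just (p i)
      exit = applyUpTo-injective n (trans (cong proj₁ (sym pdTrace-labels)) ex)
      nr′ : T (noRepeat (pGridCrossings n X N n))
      nr′ = subst (λ c → T (noRepeat (proj₂ c))) pdTrace-labels nr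

  module _ (π : Permutation′ n) (labels : permList π ≡ applyUpTo (just ∘ p) n) where

    bpd≡ : {D E : BPD π} → proj₁ D ≡ proj₁ E → D ≡ E
    bpd≡ = proj₁-injective λ D → conditions-irrelevant {bpdShape D} {noRepeat (proj₂ (bpdTrace D))}

    pd≡ : {D E : PDred π} → proj₁ D ≡ proj₁ E → D ≡ E
    pd≡ = proj₁-injective λ D → conditions-irrelevant {pdShape D} {noRepeat (proj₂ (pdTrace D))}

    decodeB : (D : BPD π) → Shuffled × ∃ λ C → bpd C ≡ proj₁ D
    decodeB (D , s , r , e) = bpd-decode D (s , r , trans e labels)

    decodeP : (D : PDred π) → Shuffled × ∃ λ C → pd C ≡ proj₁ D
    decodeP (D , s , r , e) = pd-decode D (s , r , trans e labels)

    config : BPD π → Cfg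
    config D = proj₁ (proj₂ (decodeB D))

    config-bpd : ∀ D → bpd (config D) ≡ proj₁ D
    config-bpd D = proj₂ (proj₂ (decodeB D))

    encodeB : Shuffled → Cfg → BPD π
    encodeB sh C = bpd C , bpd-shape C , proj₁ (bpd-reduced C sh) , trans (proj₂ (bpd-reduced C sh)) (sym labels)

    encodeP : Shuffled → Cfg → PDred π
    encodeP sh C = pd C , pd-shape C , proj₁ (pd-reduced C sh) , trans (proj₂ (pd-reduced C sh)) (sym labels)

    toPD : BPD π → PDred π
    toPD D = encodeP (proj₁ (decodeB D)) (config D)

    toPD-bijective : Bijective _≡_ _≡_ toPD
    toPD-bijective = injective , surjective
      where
      injective : ∀ {D E} → toPD D ≡ toPD E → D ≡ E
      injective {D} {E} e = bpd≡ (trans (sym (config-bpd D))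
        (trans (pd≡⇒bpd≡ (config D) (config E) (cong proj₁ e)) (config-bpd E)))
      surjective : ∀ P → ∃ λ D → ∀ {E} → E ≡ D → toPD E ≡ P
      -- Decoding `encodeB sh C` need not return `C`, but it returns a configuration with the same
      -- `bpd` grid and therefore with the same `pd` grid.
      surjective P = encodeB sh C , λ { {E} refl → pd≡ (trans (bpd≡⇒pd≡ (config E) C (config-bpd E)) e) }
        where
        sh = proj₁ (decodeP P)
        C  = proj₁ (proj₂ (decodeP P))
        e  = proj₂ (proj₂ (decodeP P))

    toPD-weight : ∀ D → wtBPD (proj₁ D) ≡ wtPD (proj₁ (toPD D))
    toPD-weight D = trans (cong wtBPD (sym (config-bpd D))) (weight (config D))

    toPD-order : ∀ D E → Star SimpleDroop (proj₁ D) (proj₁ E) ⇔ Star SimpleSlide (proj₁ (toPD D)) (proj₁ (toPD E))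
    toPD-order D E = mk⇔
      (λ s → droops⇒slides (config D) (config E)
        (subst₂ (Star SimpleDroop) (sym (config-bpd D)) (sym (config-bpd E)) s))
      (λ s → subst₂ (Star SimpleDroop) (config-bpd D) (config-bpd E) (slides⇒droops (config D) (config E) s))

-- From permutations to functions on indices.

module _ {n : ℕ} where

  extend : (Fin n → Fin n) → ℕ → ℕ
  extend σ i with i <? n
  ... | yes i<n = toℕ (σ (fromℕ< i<n))
  ... | no  _   = i

  extend-toℕ : ∀ σ i → extend σ (toℕ i) ≡ toℕ (σ i)
  extend-toℕ σ i with toℕ i <? n
  ... | yes i<n = cong (toℕ ∘ σ) (fromℕ<-toℕ i i<n)
  ... | no  i≮n = ⊥-elim (i≮n (toℕ<n i))

  extend-fromℕ< : ∀ σ {i} (i<n : i < n) → extend σ i ≡ toℕ (σ (fromℕ< i<n))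
  extend-fromℕ< σ i<n = trans (cong (extend σ) (sym (toℕ-fromℕ< i<n))) (extend-toℕ σ (fromℕ< i<n))

  extend< : ∀ σ {i} → i < n → extend σ i < n
  extend< σ i<n = subst (_< n) (sym (extend-fromℕ< σ i<n)) (toℕ<n _)

  extend-inverse : ∀ σ τ → (∀ i → σ (τ i) ≡ i) → ∀ {i} → i < n → extend σ (extend τ i) ≡ i
  extend-inverse σ τ h {i} i<n = trans (cong (extend σ) (extend-fromℕ< τ i<n))
    (trans (extend-toℕ σ _) (trans (cong toℕ (h _)) (toℕ-fromℕ< i<n)))

  -- The descent is the step from `k ∸ 1` to `k`; if there is none, `k = n` makes every label small.
  descent-position : ∀ σ → Grassmannian σ →
    ∃ λ k → k ≤ n × (∀ {a} → suc a < n → suc a ≢ k → extend σ a ≤ extend σ (suc a))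
  descent-position σ g with any? (λ i → any? (λ j → (toℕ j ≟ suc (toℕ i)) ×-dec (toℕ (σ j) <? toℕ (σ i))))
  ... | yes (i , j , d) = suc (toℕ i) , toℕ<n i , λ {a} a<n ≢k → ≮⇒≥ λ lt →
    ≢k (cong suc (trans (sym (toℕ-fromℕ< (<⇒≤ a<n))) (cong toℕ (sym (g i j _ _ d (descent a<n lt))))))
    where
    descent : ∀ {a} (a<n : suc a < n) → extend σ (suc a) < extend σ a → Descent σ (fromℕ< (<⇒≤ a<n)) (fromℕ< a<n)
    descent a<n lt = trans (toℕ-fromℕ< a<n) (cong suc (sym (toℕ-fromℕ< (<⇒≤ a<n)))) ,
      subst₂ _<_ (extend-fromℕ< σ a<n) (extend-fromℕ< σ (<⇒≤ a<n)) lt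
  ... | no none = n , ≤-refl , λ {a} a<n _ → ≮⇒≥ λ lt → none (_ , _ ,
    trans (toℕ-fromℕ< a<n) (cong suc (sym (toℕ-fromℕ< (<⇒≤ a<n)))) ,
    subst₂ _<_ (extend-fromℕ< σ a<n) (extend-fromℕ< σ (<⇒≤ a<n)) lt)

increasing : ∀ (f : ℕ → ℕ) {a} b → a < b → (∀ {c} → a ≤ c → c < b → f c < f (suc c)) → f a < f b
increasing f {a} (suc b) a<b h with m≤n⇒m<n∨m≡n (s≤s⁻¹ a<b)
... | inj₂ refl = h ≤-refl a<b
... | inj₁ a<b′ = <-trans (increasing f b a<b′ λ a≤c c<b → h a≤c (m<n⇒m<1+n c<b)) (h (<⇒≤ a<b′) (n<1+n b))

theorem5p9 : (n : ℕ) (π : Permutation′ n) → InverseGrassmannian π →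
    Σ (BPD π → PDred π) λ f →
    Bijective _≡_ _≡_ f
    × (∀ D → wtBPD (proj₁ D) ≡ wtPD (proj₁ (f D)))
    × (∀ D E → Star SimpleDroop (proj₁ D) (proj₁ E) ⇔ Star SimpleSlide (proj₁ (f D)) (proj₁ (f E)))
theorem5p9 n π g with descent-position (π ⟨$⟩ˡ_) g
... | k , k≤n , ascent = toPD π labels , toPD-bijective π labels , toPD-weight π labels , toPD-order π labels
  where
  p q : ℕ → ℕ
  p = extend (π ⟨$⟩ʳ_)
  q = extend (π ⟨$⟩ˡ_)
  pq : ∀ {v} → v < n → p (q v) ≡ v
  pq = extend-inverse (π ⟨$⟩ʳ_) (π ⟨$⟩ˡ_) (λ _ → inverseʳ π)
  -- Injectivity, through the inverse `p`, makes the weak ascent strict.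
  q-step : ∀ {a} → suc a < n → suc a ≢ k → q a < q (suc a)
  q-step {a} a<n ≢k = ≤∧≢⇒< (ascent a<n ≢k) λ e →
    m≢1+m+n a (trans (sym (pq (<⇒≤ a<n))) (trans (cong p e) (trans (pq a<n) (cong suc (sym (+-identityʳ a))))))
  -- The step from `c` to `suc c` may fail to ascend only if `suc c = k`. Steps between small labels
  -- have `suc c < k`, and steps between large labels have `k < suc c`.
  q-small : ∀ {a b} → a < b → b < k → q a < q b
  q-small a<b b<k = increasing q _ a<b λ _ c<b → q-step (≤-trans (s≤s c<b) (≤-trans b<k k≤n)) (<⇒≢ (≤-trans (s≤s c<b) b<k))
  q-large : ∀ {a b} → k ≤ a → a < b → b < n → q a < q b
  q-large k≤a a<b b<n = increasing q _ a<b λ a≤c c<b → q-step (≤-trans (s≤s c<b) b<n) (≢-sym (<⇒≢ (s≤s (≤-trans k≤a a≤c))))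
  open Correspondence n (n ∸ k) k (m∸n+n≡m k≤n) p q (extend< (π ⟨$⟩ʳ_)) (extend< (π ⟨$⟩ˡ_))
    (extend-inverse (π ⟨$⟩ˡ_) (π ⟨$⟩ʳ_) (λ _ → inverseˡ π)) pq q-small q-large
  labels : permList π ≡ applyUpTo (just ∘ p) n
  labels = trans (map-cong (λ i → cong just (sym (extend-toℕ (π ⟨$⟩ʳ_) i))) (allFin n)) (map-allFin (just ∘ p) n)
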